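{- Let $P$ be the set of all primes. The map $A\mapsto R_A$ from the power set $\mathcal{P}(P)$ to $[0,1]$ is surjective. That is, for each $\alpha\in[0,1]$ there is a set of primes $A\subseteq P$ such that $R_A=\alpha$.
   Context: For $A\subseteq P$, let $\Omega_A(n)$ be the number of prime factors of $n$ coming from $A$, counted with multiplicity, and let $\lambda_A(n)=(-1)^{\Omega_A(n)}$; equivalently, $\lambda_A$ is the completely multiplicative function with $\lambda_A(p)=-1$ for primes $p\in A$ and $\lambda_A(p)=1$ for primes $p\notin A$. Define the mean value $R_A:=\lim_{n\to\infty}\frac1n\sum_{k\le n}\lambda_A(k)$; this limit exists for every $A\subseteq P$, and it equals $\prod_{p\in A}\frac{p-1}{p+1}=\prod_{p\in A}\left(1-\frac{2}{p+1}\right)$ (interpreted as $0$ when $\sum_{p\in A}1/p$ diverges, and as $1$ when $A=\varnothing$). -}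

module Defs where

open import Data.Integer.Base as ℤ using (ℤ; 0ℤ; -1ℤ)
open import Data.List.Base using (length; filter)
open import Data.Nat.Base as ℕ using (ℕ; zero; suc; NonZero)
import Data.Nat.Properties as ℕ
open import Data.Nat.Primality using (Prime)
open import Data.Nat.Primality.Factorisation using (factors; factorise)
open import Data.Product.Base using (_,_; ∃-syntax)
open import Data.Rational.Base as ℚ using (ℚ; 0ℚ; 1ℚ; ½)
import Data.Rational.Properties as ℚ
open import Data.Rational.Solver using (module +-*-Solver)
open import Data.Sum.Base using (inj₁; inj₂)
open import Level using (0ℓ)
open import Relation.Binary.PropositionalEquality
  using (_≡_; refl; sym; trans; cong; cong₂; subst; subst₂)
open import Relation.Unary using (Pred; Decidable; _⊆_)

------------------------------------------------------------------------
-- Rational estimates used to close the Cauchy reals under _-_ and ∣_∣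

private

  ½ε>0 : ∀ {ε} → 0ℚ ℚ.< ε → 0ℚ ℚ.< ½ ℚ.* ε
  ½ε>0 {ε} ε>0 =
    subst (ℚ._< ½ ℚ.* ε) (ℚ.*-zeroʳ ½) (ℚ.*-monoʳ-<-pos ½ ε>0)

  ½ε+½ε≡ε : ∀ ε → ½ ℚ.* ε ℚ.+ ½ ℚ.* ε ≡ ε
  ½ε+½ε≡ε ε = trans (sym (ℚ.*-distribʳ-+ ε ½ ½)) (ℚ.*-identityˡ ε)

  ∣-∣-interchange : ∀ a b c d →
    ℚ.∣ (a ℚ.- b) ℚ.- (c ℚ.- d) ∣ ℚ.≤ ℚ.∣ a ℚ.- c ∣ ℚ.+ ℚ.∣ b ℚ.- d ∣
  ∣-∣-interchange a b c d =
    subst (λ z → ℚ.∣ z ∣ ℚ.≤ ℚ.∣ a ℚ.- c ∣ ℚ.+ ℚ.∣ b ℚ.- d ∣)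
      (solve 4 (λ a b c d → (a :- c) :- (b :- d) := (a :- b) :- (c :- d))
        refl a b c d)
      (ℚ.∣p-q∣≤∣p∣+∣q∣ (a ℚ.- c) (b ℚ.- d))
    where open +-*-Solver

  ∣p∣-∣q∣≤∣p-q∣ : ∀ p q → ℚ.∣ p ∣ ℚ.- ℚ.∣ q ∣ ℚ.≤ ℚ.∣ p ℚ.- q ∣
  ∣p∣-∣q∣≤∣p-q∣ p q =
    subst₂ (λ x y → ℚ.∣ x ∣ ℚ.- ℚ.∣ q ∣ ℚ.≤ y)
      (solve 2 (λ p q → (p :- q) :+ q := p) refl p q)
      (solve 2 (λ r s → (r :+ s) :- s := r) refl ℚ.∣ p ℚ.- q ∣ ℚ.∣ q ∣)
      (ℚ.+-monoˡ-≤ (ℚ.- ℚ.∣ q ∣) (ℚ.∣p+q∣≤∣p∣+∣q∣ (p ℚ.- q) q))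
    where open +-*-Solver

  ∣∣p∣-∣q∣∣≤∣p-q∣ : ∀ p q → ℚ.∣ ℚ.∣ p ∣ ℚ.- ℚ.∣ q ∣ ∣ ℚ.≤ ℚ.∣ p ℚ.- q ∣
  ∣∣p∣-∣q∣∣≤∣p-q∣ p q with ℚ.∣p∣≡p∨∣p∣≡-p (ℚ.∣ p ∣ ℚ.- ℚ.∣ q ∣)
  ... | inj₁ eq = subst (ℚ._≤ ℚ.∣ p ℚ.- q ∣) (sym eq) (∣p∣-∣q∣≤∣p-q∣ p q)
  ... | inj₂ eq = subst₂ ℚ._≤_
    (sym (trans eq (flip-minus ℚ.∣ p ∣ ℚ.∣ q ∣)))
    (trans (cong ℚ.∣_∣ (sym (flip-minus p q))) (ℚ.∣-p∣≡∣p∣ (p ℚ.- q)))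
    (∣p∣-∣q∣≤∣p-q∣ q p)
    where
    open +-*-Solver
    flip-minus : ∀ x y → ℚ.- (x ℚ.- y) ≡ y ℚ.- x
    flip-minus = solve 2 (λ x y → :- (x :- y) := y :- x) refl

------------------------------------------------------------------------
-- Real numbers as Cauchy sequences of rationals

-- Two sequences may represent the same real number: equality of reals is
-- x ≤ y together with y ≤ x, not propositional equality of representatives.

record ℝ : Set where
  field
    seq    : ℕ → ℚ
    cauchy : ∀ ε → 0ℚ ℚ.< ε →
             ∃[ N ] (∀ m n → N ℕ.≤ m → N ℕ.≤ n → ℚ.∣ seq m ℚ.- seq n ∣ ℚ.< ε)

open ℝ

fromℚ : ℚ → ℝ
fromℚ q .seq    _       = q
fromℚ q .cauchy ε ε>0 = 0 , λ _ _ _ _ →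
  subst (λ z → ℚ.∣ z ∣ ℚ.< ε) (sym (ℚ.+-inverseʳ q)) ε>0

0ℝ 1ℝ : ℝ
0ℝ = fromℚ 0ℚ
1ℝ = fromℚ 1ℚ

infixl 6 _-_
infix  4 _≤_ _⟶_

_-_ : ℝ → ℝ → ℝ
(x - y) .seq n = seq x n ℚ.- seq y n
(x - y) .cauchy ε ε>0 with cauchy x (½ ℚ.* ε) (½ε>0 ε>0)
                         | cauchy y (½ ℚ.* ε) (½ε>0 ε>0)
... | M , hx | N , hy = M ℕ.⊔ N , λ m n m≥ n≥ →
  ℚ.≤-<-trans
    (∣-∣-interchange (seq x m) (seq y m) (seq x n) (seq y n))
    (subst (_ ℚ.<_) (½ε+½ε≡ε ε)
      (ℚ.+-mono-<
        (hx m n (ℕ.m⊔n≤o⇒m≤o M N m≥) (ℕ.m⊔n≤o⇒m≤o M N n≥))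
        (hy m n (ℕ.m⊔n≤o⇒n≤o M N m≥) (ℕ.m⊔n≤o⇒n≤o M N n≥))))

∣_∣ : ℝ → ℝ
∣ x ∣ .seq n = ℚ.∣ seq x n ∣
∣ x ∣ .cauchy ε ε>0 with cauchy x ε ε>0
... | N , hx = N , λ m n m≥ n≥ →
  ℚ.≤-<-trans (∣∣p∣-∣q∣∣≤∣p-q∣ (seq x m) (seq x n)) (hx m n m≥ n≥)

-- Termwise comparison would depend on the representatives; the slack ε makes
-- this the order of the represented real numbers.

_≤_ : ℝ → ℝ → Set
x ≤ y = ∀ ε → 0ℚ ℚ.< ε →
        ∃[ N ] (∀ n → N ℕ.≤ n → seq x n ℚ.≤ seq y n ℚ.+ ε)

_⟶_ : (ℕ → ℝ) → ℝ → Set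
s ⟶ x = ∀ ε → 0ℚ ℚ.< ε →
        ∃[ N ] (∀ n → N ℕ.≤ n → ∣ s n - x ∣ ≤ fromℚ ε)

------------------------------------------------------------------------
-- Sets of primes and the functions λ_A

-- Decidability of membership is what makes Ω_A(n) a natural number
-- constructively; classically it is no restriction.

record PrimeSet : Set₁ where
  field
    member  : Pred ℕ 0ℓ
    member? : Decidable member
    primes  : member ⊆ Prime

open PrimeSet

Ω : PrimeSet → (n : ℕ) .{{_ : NonZero n}} → ℕ
Ω A n = length (filter (member? A) (factors (factorise n)))

liouville : PrimeSet → (n : ℕ) .{{_ : NonZero n}} → ℤ
liouville A n = -1ℤ ℤ.^ Ω A n

-- ∑_{1 ≤ k ≤ n} λ_A(k)

summatory : PrimeSet → ℕ → ℤ
summatory A zero    = 0ℤ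
summatory A (suc n) = summatory A n ℤ.+ liouville A (suc n)

average : PrimeSet → (n : ℕ) .{{_ : NonZero n}} → ℚ
average A n = summatory A n ℚ./ n

-- R_A = α: the limit defining R_A exists and is α. The averages are indexed
-- from n = 1, hence the shift.

R[_]≡_ : PrimeSet → ℝ → Set
R[ A ]≡ α = (λ n → fromℚ (average A (suc n))) ⟶ α

{-# OPTIONS --safe #-}
module Submission where

-- Primes are accepted greedily: p joins A if the product P of the factors (p - 1) / (p + 1) then stays
-- above a threshold c. The threshold is constant on each stage (T k, T (k + 1)] and tends to α so slowly
-- that c k ≤ (1 + u k) c (k + 1) with u k = 2 / (k + 16). Since T (k + 1) is exponentially larger than T k,
-- few integers up to T (k + 1) have only prime factors up to T k, so accepting every prime of a stage
-- would shrink P by a factor of 8/11. This would overshoot the threshold, so some prime is rejected, and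
-- P is then within the factor 1 + u k of c k.
--
-- For the averages, changing a completely multiplicative function from χ to ψ at the single prime p changes
-- its summatory function by ψ(p) F_ψ(x/p) - χ(p) F_χ(x/p). Iterating this gives the main term P(y) x for the
-- primes up to y = T (k + 1), with an error term exponential in y that is negligible for x ≥ T (k + 2), while
-- the primes between y and x contribute at most 2 x (P(y) - P(x)) / P(x), which is small because P varies
-- little there.

open import Defs hiding (_≤_; _-_; ∣_∣)

open import Data.Integer.Base as ℤ using (ℤ)
import Data.Integer.Properties as ℤ
open import Data.List.Base using (List; []; _∷_; foldr; filter; length)
open import Data.List.Membership.Propositional using (_∈_)
open import Data.List.Relation.Binary.Permutation.Propositional 
  using (_↭_; refl; prep; swap) renaming (trans to ↭-trans)
open import Data.List.Relation.Unary.All as All using (All; []; _∷_)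
open import Data.List.Relation.Unary.Any using (here; there)
open import Data.Nat.Base as ℕ using (ℕ; zero; suc; NonZero; z≤n; s≤s)
open import Data.Nat.Divisibility using (_∣_; ∣m+n∣m⇒∣n; n∣m*n; >⇒∤; ∣⇒≤)
open import Data.Nat.DivMod using (m≡m%n+[m/n]*n; m%n<n; m<n*o⇒m/o<n; m/n*n≤m)
open import Data.Nat.ListAction.Properties using (∈⇒∣product)
open import Data.Nat.Primality using (Prime; prime?; prime⇒nonZero; prime⇒nonTrivial; ¬prime[1])
open import Data.Nat.Primality.Factorisation
  using (PrimeFactorisation; factors; factorise; factorisationUnique)
import Data.Nat.Properties as ℕ
open import Data.Product.Base using (_×_; _,_; proj₁; proj₂; ∃-syntax)
open import Data.Rational.Base hiding (NonZero)
open import Data.Rational.Properties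
open import Data.Rational.Solver using (module +-*-Solver)
import Data.Rational.Unnormalised.Base as ℚᵘ
import Data.Rational.Unnormalised.Properties as ℚᵘ
open import Data.Empty using (⊥)
open import Data.Sum.Base as Sum using (_⊎_; inj₁; inj₂; [_,_]′)
open import Function.Base using (_∘_)
open import Relation.Binary.PropositionalEquality
open import Relation.Nullary using (¬_; Dec; yes; no; contradiction)
open import Relation.Nullary.Decidable using (from-yes; _×-dec_; ¬?)

open +-*-Solver using (solve; _:+_; _:*_; _:-_; :-_; _:=_; con)

-- Naturals inside ℚ

-- Defined by recursion, so that `ι (suc n)` unfolds to `1ℚ + ι n` and the ring solver can treat
-- shifted arguments as polynomials.
ι : ℕ → ℚ
ι zero    = 0ℚ
ι (suc n) = 1ℚ + ι n

ι-+ : ∀ m n → ι (m ℕ.+ n) ≡ ι m + ι n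
ι-+ zero    n = sym (+-identityˡ (ι n))
ι-+ (suc m) n = trans (cong (λ z → 1ℚ + z) (ι-+ m n)) (sym (+-assoc 1ℚ (ι m) (ι n)))

ι-* : ∀ m n → ι (m ℕ.* n) ≡ ι m * ι n
ι-* zero    n = sym (*-zeroˡ (ι n))
ι-* (suc m) n = trans (ι-+ n (m ℕ.* n)) (trans (cong (λ z → ι n + z) (ι-* m n))
  (solve 2 (λ a b → b :+ a :* b := (con 1ℚ :+ a) :* b) refl (ι m) (ι n)))

/1-+ : ∀ i j → (i ℤ.+ j) / 1 ≡ i / 1 + j / 1
/1-+ i j = toℚᵘ-injective (begin
  toℚᵘ ((i ℤ.+ j) / 1)            ≈⟨ toℚᵘ-fromℚᵘ (ℚᵘ.mkℚᵘ (i ℤ.+ j) 0) ⟩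
  ℚᵘ.mkℚᵘ (i ℤ.+ j) 0             ≈⟨ ℚᵘ.*≡* (cong (ℤ._* ℤ.+ 1)
                                       (sym (cong₂ ℤ._+_ (ℤ.*-identityʳ i) (ℤ.*-identityʳ j)))) ⟩
  ℚᵘ.mkℚᵘ i 0 ℚᵘ.+ ℚᵘ.mkℚᵘ j 0    ≈⟨ ℚᵘ.+-cong (toℚᵘ-fromℚᵘ (ℚᵘ.mkℚᵘ i 0))
                                               (toℚᵘ-fromℚᵘ (ℚᵘ.mkℚᵘ j 0)) ⟨
  toℚᵘ (i / 1) ℚᵘ.+ toℚᵘ (j / 1)  ≈⟨ toℚᵘ-homo-+ (i / 1) (j / 1) ⟨
  toℚᵘ (i / 1 + j / 1)            ∎)
  where open ℚᵘ.≃-Reasoning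

ι≡/1 : ∀ n → ι n ≡ ℤ.+ n / 1
ι≡/1 zero    = refl
ι≡/1 (suc n) = trans (cong (λ z → 1ℚ + z) (ι≡/1 n)) (sym (/1-+ (ℤ.+ 1) (ℤ.+ n)))

-- Lets `ratio`, `u` and `average` be handled with their denominators cleared.
/-*-cancel : ∀ i n → (i / suc n) * ι (suc n) ≡ i / 1
/-*-cancel i n = trans (cong (λ z → (i / suc n) * z) (ι≡/1 (suc n))) (toℚᵘ-injective (begin
  toℚᵘ ((i / suc n) * (ℤ.+ suc n / 1))        ≈⟨ toℚᵘ-homo-* (i / suc n) (ℤ.+ suc n / 1) ⟩
  toℚᵘ (i / suc n) ℚᵘ.* toℚᵘ (ℤ.+ suc n / 1)  ≈⟨ ℚᵘ.*-cong (toℚᵘ-fromℚᵘ (ℚᵘ.mkℚᵘ i n))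
                                                          (toℚᵘ-fromℚᵘ (ℚᵘ.mkℚᵘ (ℤ.+ suc n) 0)) ⟩
  ℚᵘ.mkℚᵘ i n ℚᵘ.* ℚᵘ.mkℚᵘ (ℤ.+ suc n) 0      ≈⟨ ℚᵘ.*≡* (trans (ℤ.*-identityʳ _)
                                                   (cong (i ℤ.*_) (sym (ℤ.*-identityʳ (ℤ.+ suc n))))) ⟩
  ℚᵘ.mkℚᵘ i 0                                 ≈⟨ toℚᵘ-fromℚᵘ (ℚᵘ.mkℚᵘ i 0) ⟨
  toℚᵘ (i / 1)                                ∎))
  where open ℚᵘ.≃-Reasoning

-- Order on ℚ

-- Most inequalities below are proved by a certificate: `e` is an expression that is visibly
-- nonnegative, assembled with `_⊕_` and `_⊛_`, and the ring solver checks the identity.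
≤-from-diff : ∀ {a b} e → 0ℚ ≤ e → b ≡ a + e → a ≤ b
≤-from-diff {a} e 0≤e refl = subst (_≤ a + e) (+-identityʳ a) (+-monoʳ-≤ a 0≤e)

0≤-diff : ∀ {a b} → a ≤ b → 0ℚ ≤ b - a
0≤-diff {a} {b} a≤b = subst (_≤ b - a) (+-inverseʳ a) (+-monoˡ-≤ (- a) a≤b)

infixl 6 _⊕_
infixl 7 _⊛_

_⊕_ : ∀ {a b} → 0ℚ ≤ a → 0ℚ ≤ b → 0ℚ ≤ a + b
_⊕_ = +-mono-≤

_⊛_ : ∀ {a b} → 0ℚ ≤ a → 0ℚ ≤ b → 0ℚ ≤ a * b
_⊛_ {a} {b} 0≤a 0≤b = subst (_≤ a * b) (*-zeroʳ a) (*-monoˡ-≤-nonNeg a {{nonNegative 0≤a}} 0≤b)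

0≤1 : 0ℚ ≤ 1ℚ
0≤1 = *≤* (ℤ.+≤+ z≤n)

ι≥0 : ∀ n → 0ℚ ≤ ι n
ι≥0 zero    = ≤-refl
ι≥0 (suc n) = 0≤1 ⊕ ι≥0 n

ι-mono : ∀ {m n} → m ℕ.≤ n → ι m ≤ ι n
ι-mono {m} {n} m≤n = ≤-from-diff (ι (n ℕ.∸ m)) (ι≥0 (n ℕ.∸ m))
  (trans (cong ι (sym (ℕ.m+[n∸m]≡n m≤n))) (ι-+ m _))

ι>0 : ∀ n → 0ℚ < ι (suc n)
ι>0 n = <-≤-trans (*<* (ℤ.+<+ (s≤s z≤n))) (ι-mono {1} {suc n} (s≤s z≤n))

ι-pos : ∀ {m n} → m ℕ.< n → 0ℚ < ι n
ι-pos {n = suc n} _ = ι>0 n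

*-monoʳ : ∀ {r p q} → 0ℚ ≤ r → p ≤ q → r * p ≤ r * q
*-monoʳ {r} 0≤r = *-monoˡ-≤-nonNeg r {{nonNegative 0≤r}}

*-cancel : ∀ {r p q} → 0ℚ < r → r * p ≤ r * q → p ≤ q
*-cancel {r} 0<r = *-cancelˡ-≤-pos r {{positive 0<r}}

∣∣≤ : ∀ {x b} → x ≤ b → - x ≤ b → ∣ x ∣ ≤ b
∣∣≤ {x} x≤b -x≤b with ∣p∣≡p∨∣p∣≡-p x
... | inj₁ eq = subst (_≤ _) (sym eq) x≤b
... | inj₂ eq = subst (_≤ _) (sym eq) -x≤b

x≤∣x∣ : ∀ x → x ≤ ∣ x ∣
x≤∣x∣ x with ≤-total 0ℚ x
... | inj₁ 0≤x = ≤-reflexive (sym (0≤p⇒∣p∣≡p 0≤x))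
... | inj₂ x≤0 = ≤-trans x≤0 (0≤∣p∣ x)

-x≤∣x∣ : ∀ x → - x ≤ ∣ x ∣
-x≤∣x∣ x = subst (- x ≤_) (∣-p∣≡∣p∣ x) (x≤∣x∣ (- x))

-- Completely multiplicative functions and their summatory functions

value : (ℕ → ℚ) → List ℕ → ℚ
value χ = foldr (λ p z → χ p * z) 1ℚ

-- Arbitrary rational values at the primes cover both λ_A, with values 1 and -1, and indicator
-- functions, with values 1 and 0.
ext : (ℕ → ℚ) → (n : ℕ) .{{_ : NonZero n}} → ℚ
ext χ n = value χ (factors (factorise n))

F : (ℕ → ℚ) → ℕ → ℚ
F χ zero    = 0ℚ
F χ (suc n) = F χ n + ext χ (suc n)

value-↭ : ∀ χ {ps qs} → ps ↭ qs → value χ ps ≡ value χ qs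
value-↭ χ refl         = refl
value-↭ χ (prep p r)   = cong (χ p *_) (value-↭ χ r)
value-↭ χ (swap p q r) = trans (cong (λ z → χ p * (χ q * z)) (value-↭ χ r))
  (solve 3 (λ a b c → a :* (b :* c) := b :* (a :* c)) refl (χ p) (χ q) _)
value-↭ χ (↭-trans r s) = trans (value-↭ χ r) (value-↭ χ s)

-- Prepending `p` to the factors of `n` gives a prime factorisation of `p * n`, which by uniqueness
-- is a permutation of the chosen one.
ext-* : ∀ χ {p} → Prime p → ∀ n .{{_ : NonZero n}} .{{_ : NonZero (p ℕ.* n)}} →
        ext χ (p ℕ.* n) ≡ χ p * ext χ n
ext-* χ {p} pr n = value-↭ χ (factorisationUnique (factorise (p ℕ.* n)) (record
  { factors         = p ∷ factors (factorise n)
  ; isFactorisation = cong (p ℕ.*_) (PrimeFactorisation.isFactorisation (factorise n))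
  ; factorsPrime    = pr ∷ PrimeFactorisation.factorsPrime (factorise n)
  }))

value-cong : ∀ {χ ψ} ps → (∀ {q} → q ∈ ps → χ q ≡ ψ q) → value χ ps ≡ value ψ ps
value-cong []       eq = refl
value-cong (p ∷ ps) eq = cong₂ _*_ (eq (here refl)) (value-cong ps (eq ∘ there))

ext-cong : ∀ {χ ψ} n .{{_ : NonZero n}} → (∀ {q} → Prime q → q ∣ n → χ q ≡ ψ q) → ext χ n ≡ ext ψ n
ext-cong n eq = value-cong (factors f) λ q∈ →
  eq (All.lookup (PrimeFactorisation.factorsPrime f) q∈)
     (subst (_ ∣_) (sym (PrimeFactorisation.isFactorisation f)) (∈⇒∣product q∈))
  where f = factorise n

F-cong : ∀ {χ ψ} x → (∀ {q} → Prime q → q ℕ.≤ x → χ q ≡ ψ q) → F χ x ≡ F ψ x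
F-cong zero    eq = refl
F-cong (suc x) eq = cong₂ _+_ (F-cong x (λ pr q≤x → eq pr (ℕ.m≤n⇒m≤1+n q≤x)))
                              (ext-cong (suc x) (λ pr q∣ → eq pr (∣⇒≤ q∣)))

∣value∣≤1 : ∀ {χ} → (∀ q → ∣ χ q ∣ ≤ 1ℚ) → ∀ ps → ∣ value χ ps ∣ ≤ 1ℚ
∣value∣≤1 b [] = ≤-refl
∣value∣≤1 {χ} b (p ∷ ps) = begin
  ∣ χ p * value χ ps ∣      ≡⟨ ∣p*q∣≡∣p∣*∣q∣ (χ p) _ ⟩
  ∣ χ p ∣ * ∣ value χ ps ∣  ≤⟨ *-monoʳ (0≤∣p∣ (χ p)) (∣value∣≤1 b ps) ⟩
  ∣ χ p ∣ * 1ℚ              ≡⟨ *-identityʳ _ ⟩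
  ∣ χ p ∣                   ≤⟨ b p ⟩
  1ℚ                        ∎
  where open ≤-Reasoning

∣F∣≤ : ∀ {χ} → (∀ q → ∣ χ q ∣ ≤ 1ℚ) → ∀ x → ∣ F χ x ∣ ≤ ι x
∣F∣≤ b zero = ≤-refl
∣F∣≤ {χ} b (suc x) = begin
  ∣ F χ x + ext χ (suc x) ∣      ≤⟨ ∣p+q∣≤∣p∣+∣q∣ (F χ x) _ ⟩
  ∣ F χ x ∣ + ∣ ext χ (suc x) ∣  ≤⟨ +-mono-≤ (∣F∣≤ b x) (∣value∣≤1 b (factors (factorise (suc x)))) ⟩
  ι x + 1ℚ                       ≡⟨ +-comm (ι x) 1ℚ ⟩
  ι (suc x)                      ∎
  where open ≤-Reasoning

value-1 : ∀ ps → value (λ _ → 1ℚ) ps ≡ 1ℚ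
value-1 []       = refl
value-1 (p ∷ ps) = trans (*-identityˡ _) (value-1 ps)

F-1 : ∀ x → F (λ _ → 1ℚ) x ≡ ι x
F-1 zero    = refl
F-1 (suc x) = trans (cong₂ _+_ (F-1 x) (value-1 (factors (factorise (suc x))))) (+-comm (ι x) 1ℚ)

-- Only `n = 1` has an empty factorisation; every other term contains a factor 0.
F-0 : ∀ x → F (λ _ → 0ℚ) (suc x) ≡ 1ℚ
F-0 zero    = refl
F-0 (suc x) = trans (cong₂ _+_ (F-0 x) (ext-0 x)) (+-identityʳ 1ℚ)
  where
  ext-0 : ∀ n → ext (λ _ → 0ℚ) (2 ℕ.+ n) ≡ 0ℚ
  ext-0 n with factorise (2 ℕ.+ n)
  ... | record { factors = [] ; isFactorisation = () }
  ... | record { factors = p ∷ ps } = *-zeroˡ (value (λ _ → 0ℚ) ps)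

-- Both sides sum the values at the n ≤ x prime to p.
F-sieve : ∀ {χ ψ p} .{{_ : NonZero p}} → Prime p → (∀ {q} → Prime q → q ≢ p → χ q ≡ ψ q) → ∀ x →
          F χ x - χ p * F χ (x ℕ./ p) ≡ F ψ x - ψ p * F ψ (x ℕ./ p)
F-sieve {χ} {ψ} {suc p} pr eq x =
  subst (λ z → F χ z - χ (suc p) * F χ (x ℕ./ suc p) ≡ F ψ z - ψ (suc p) * F ψ (x ℕ./ suc p))
    (trans (ℕ.+-comm _ (x ℕ.% suc p)) (sym (m≡m%n+[m/n]*n x (suc p))))
    (go (x ℕ./ suc p) (x ℕ.% suc p) (ℕ.s≤s⁻¹ (m%n<n x (suc p))))
  where
  G : (ℕ → ℚ) → ℕ → ℕ → ℚ
  G χ k r = F χ (k ℕ.* suc p ℕ.+ r) - χ (suc p) * F χ k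

  -- At the next multiple of the prime, the new term of the first sum is `c * ext χ (suc k)`, which
  -- is exactly the growth of the subtracted sum.
  G-suc : ∀ χ k → G χ (suc k) 0 ≡ G χ k p
  G-suc χ k = begin
    F χ (suc (p ℕ.+ k ℕ.* suc p ℕ.+ 0)) - c * (F χ k + ext χ (suc k))
      ≡⟨ cong (λ z → F χ (suc z) - c * (F χ k + ext χ (suc k))) (trans (ℕ.+-identityʳ _) (ℕ.+-comm p _)) ⟩
    F χ m + ext χ (suc m) - c * (F χ k + ext χ (suc k))
      ≡⟨ cong (λ z → F χ m + z - c * (F χ k + ext χ (suc k))) ext-m ⟩
    F χ m + c * ext χ (suc k) - c * (F χ k + ext χ (suc k))
      ≡⟨ solve 4 (λ a c e f → a :+ c :* e :- c :* (f :+ e) := a :- c :* f) refl (F χ m) c (ext χ (suc k)) (F χ k) ⟩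
    F χ m - c * F χ k ∎
    where
    open ≡-Reasoning
    c = χ (suc p)
    m = k ℕ.* suc p ℕ.+ p
    ext-cong-≡ : ∀ {a b} .{{_ : NonZero a}} .{{_ : NonZero b}} → a ≡ b → ext χ a ≡ ext χ b
    ext-cong-≡ refl = refl
    ext-m : ext χ (suc m) ≡ c * ext χ (suc k)
    ext-m = trans (ext-cong-≡ (trans (cong suc (ℕ.+-comm (k ℕ.* suc p) p)) (ℕ.*-comm (suc k) (suc p))))
                  (ext-* χ pr (suc k))

  go : ∀ k r → r ℕ.≤ p → G χ k r ≡ G ψ k r
  go zero    zero    _   = solve 2 (λ a b → con 0ℚ :- a :* con 0ℚ := con 0ℚ :- b :* con 0ℚ)
                                 refl (χ (suc p)) (ψ (suc p))
  go (suc k) zero    _   = trans (G-suc χ k) (trans (go k p ℕ.≤-refl) (sym (G-suc ψ k)))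
  go k       (suc r) r<p = begin
    F χ (k ℕ.* suc p ℕ.+ suc r) - a
      ≡⟨ cong (λ z → F χ z - a) (ℕ.+-suc (k ℕ.* suc p) r) ⟩
    F χ m + ext χ (suc m) - a
      ≡⟨ solve 3 (λ f e a → f :+ e :- a := (f :- a) :+ e) refl (F χ m) _ a ⟩
    (F χ m - a) + ext χ (suc m)
      ≡⟨ cong₂ _+_ (go k r (ℕ.<⇒≤ r<p)) (ext-cong (suc m) (λ prq q∣ → eq prq (λ { refl → p∤ q∣ }))) ⟩
    (F ψ m - b) + ext ψ (suc m)
      ≡⟨ solve 3 (λ f e a → (f :- a) :+ e := f :+ e :- a) refl (F ψ m) _ b ⟩
    F ψ m + ext ψ (suc m) - b
      ≡⟨ cong (λ z → F ψ z - b) (ℕ.+-suc (k ℕ.* suc p) r) ⟨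
    F ψ (k ℕ.* suc p ℕ.+ suc r) - b ∎
    where
    open ≡-Reasoning
    a = χ (suc p) * F χ k
    b = ψ (suc p) * F ψ k
    m = k ℕ.* suc p ℕ.+ r
    p∤ : ¬ suc p ∣ suc m
    p∤ p∣ = >⇒∤ (s≤s r<p) (∣m+n∣m⇒∣n (subst (suc p ∣_) (sym (ℕ.+-suc (k ℕ.* suc p) r)) p∣) (n∣m*n k))

-- Changing the values at the primes one at a time

splice : (ℕ → ℚ) → (ℕ → ℚ) → ℕ → ℕ → ℚ
splice χ ψ y q with q ℕ.≤? y
... | yes _ = χ q
... | no  _ = ψ q

splice-≤ : ∀ χ ψ {y q} → q ℕ.≤ y → splice χ ψ y q ≡ χ q
splice-≤ χ ψ {y} {q} q≤y with q ℕ.≤? y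
... | yes _   = refl
... | no  q≰y = contradiction q≤y q≰y

splice-> : ∀ χ ψ {y q} → y ℕ.< q → splice χ ψ y q ≡ ψ q
splice-> χ ψ {y} {q} y<q with q ℕ.≤? y
... | yes q≤y = contradiction q≤y (ℕ.<⇒≱ y<q)
... | no  _   = refl

splice-suc : ∀ χ ψ y {q} → q ≢ suc y → splice χ ψ (suc y) q ≡ splice χ ψ y q
splice-suc χ ψ y {q} q≢ with ℕ.<-≤-connex y q
... | inj₁ y<q = trans (splice-> χ ψ (ℕ.≤∧≢⇒< y<q (q≢ ∘ sym))) (sym (splice-> χ ψ y<q))
... | inj₂ q≤y = trans (splice-≤ χ ψ (ℕ.m≤n⇒m≤1+n q≤y)) (sym (splice-≤ χ ψ q≤y))

module _ (χ ψ : ℕ → ℚ) where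

  H : ℕ → ℕ → ℚ
  H y = F (splice χ ψ y)

  H-0 : ∀ x → H 0 x ≡ F ψ x
  H-0 x = F-cong x λ pr _ → splice-> χ ψ (ℕ.>-nonZero⁻¹ _ {{prime⇒nonZero pr}})

  H-all : ∀ {x y} → x ℕ.≤ y → H y x ≡ F χ x
  H-all x≤y = F-cong _ λ _ q≤x → splice-≤ χ ψ (ℕ.≤-trans q≤x x≤y)

  H-skip : ∀ y → ¬ Prime (suc y) ⊎ χ (suc y) ≡ ψ (suc y) → ∀ x → H (suc y) x ≡ H y x
  H-skip y same x = F-cong x (λ pr _ → agree pr)
    where
    agree : ∀ {q} → Prime q → splice χ ψ (suc y) q ≡ splice χ ψ y q
    agree {q} pr with q ℕ.≟ suc y
    ... | no q≢    = splice-suc χ ψ y q≢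
    ... | yes refl = [ contradiction pr , (λ χ≡ψ →
      trans (splice-≤ χ ψ ℕ.≤-refl) (trans χ≡ψ (sym (splice-> χ ψ ℕ.≤-refl)))) ]′ same

  -- The two splices differ only at the prime `suc y`, so this is the sieve identity solved for
  -- `H (suc y) x`.
  H-step : ∀ y → Prime (suc y) → ∀ x → let k = x ℕ./ suc y in
           H (suc y) x ≡ H y x + (χ (suc y) * H (suc y) k - ψ (suc y) * H y k)
  H-step y pr x = begin
    H (suc y) x
      ≡⟨ solve 2 (λ a b → a := a :- b :+ b) refl (H (suc y) x) (χ (suc y) * H (suc y) k) ⟩
    H (suc y) x - χ (suc y) * H (suc y) k + χ (suc y) * H (suc y) k
      ≡⟨ cong (λ z → H (suc y) x - z * H (suc y) k + χ (suc y) * H (suc y) k) (splice-≤ χ ψ {suc y} ℕ.≤-refl) ⟨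
    H (suc y) x - splice χ ψ (suc y) (suc y) * H (suc y) k + χ (suc y) * H (suc y) k
      ≡⟨ cong (_+ χ (suc y) * H (suc y) k) (F-sieve pr (λ _ → splice-suc χ ψ y) x) ⟩
    H y x - splice χ ψ y (suc y) * H y k + χ (suc y) * H (suc y) k
      ≡⟨ cong (λ z → H y x - z * H y k + χ (suc y) * H (suc y) k) (splice-> χ ψ {y} ℕ.≤-refl) ⟩
    H y x - ψ (suc y) * H y k + χ (suc y) * H (suc y) k
      ≡⟨ solve 3 (λ a b c → a :- b :+ c := a :+ (c :- b)) refl (H y x) _ _ ⟩
    H y x + (χ (suc y) * H (suc y) k - ψ (suc y) * H y k) ∎
    where
    open ≡-Reasoning
    k = x ℕ./ suc y

  -- The total effect of the changes, weighted by a decreasing product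

  module _ (∣χ∣≤1 : ∀ q → ∣ χ q ∣ ≤ 1ℚ) (∣ψ∣≤1 : ∀ q → ∣ ψ q ∣ ≤ 1ℚ) where

    ∣splice∣≤1 : ∀ y q → ∣ splice χ ψ y q ∣ ≤ 1ℚ
    ∣splice∣≤1 y q with q ℕ.≤? y
    ... | yes _ = ∣χ∣≤1 q
    ... | no  _ = ∣ψ∣≤1 q

    -- Both correction terms in `H-step` are at most `k` in absolute value, and `k * suc y` is at
    -- most `x`.
    ∣H-step∣ : ∀ y → Prime (suc y) → ∀ x → ι (suc y) * ∣ H (suc y) x - H y x ∣ ≤ ι 2 * ι x
    ∣H-step∣ y pr x = begin
      ι (suc y) * ∣ H (suc y) x - H y x ∣
        ≡⟨ cong (λ z → ι (suc y) * ∣ z - H y x ∣) (H-step y pr x) ⟩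
      ι (suc y) * ∣ H y x + (c * H (suc y) k - d * H y k) - H y x ∣
        ≡⟨ cong (λ z → ι (suc y) * ∣ z ∣) (solve 2 (λ a b → a :+ b :- a := b) refl (H y x) _) ⟩
      ι (suc y) * ∣ c * H (suc y) k - d * H y k ∣
        ≤⟨ *-monoʳ (ι≥0 (suc y)) (∣p-q∣≤∣p∣+∣q∣ (c * H (suc y) k) (d * H y k)) ⟩
      ι (suc y) * (∣ c * H (suc y) k ∣ + ∣ d * H y k ∣)
        ≤⟨ *-monoʳ (ι≥0 (suc y)) (+-mono-≤ (bound (∣χ∣≤1 _) (∣F∣≤ (∣splice∣≤1 (suc y)) k))
                                           (bound (∣ψ∣≤1 _) (∣F∣≤ (∣splice∣≤1 y) k))) ⟩
      ι (suc y) * (ι k + ι k)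
        ≡⟨ solve 2 (λ a b → a :* (b :+ b) := con (ι 2) :* (b :* a)) refl (ι (suc y)) (ι k) ⟩
      ι 2 * (ι k * ι (suc y))
        ≡⟨ cong (ι 2 *_) (ι-* k (suc y)) ⟨
      ι 2 * ι (k ℕ.* suc y)
        ≤⟨ *-monoʳ (ι≥0 2) (ι-mono (m/n*n≤m x (suc y))) ⟩
      ι 2 * ι x ∎
      where
      open ≤-Reasoning
      k = x ℕ./ suc y
      c = χ (suc y)
      d = ψ (suc y)
      bound : ∀ {a b} → ∣ a ∣ ≤ 1ℚ → ∣ b ∣ ≤ ι k → ∣ a * b ∣ ≤ ι k
      bound {a} {b} ∣a∣≤1 ∣b∣≤k = begin
        ∣ a * b ∣      ≡⟨ ∣p*q∣≡∣p∣*∣q∣ a b ⟩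
        ∣ a ∣ * ∣ b ∣  ≡⟨ *-comm ∣ a ∣ ∣ b ∣ ⟩
        ∣ b ∣ * ∣ a ∣  ≤⟨ *-monoʳ (0≤∣p∣ b) ∣a∣≤1 ⟩
        ∣ b ∣ * 1ℚ     ≡⟨ *-identityʳ ∣ b ∣ ⟩
        ∣ b ∣          ≤⟨ ∣b∣≤k ⟩
        ι k            ∎

    -- P is the product of (p - 1) / (p + 1) over the primes p at which χ and ψ may differ;
    -- the sum of 2 / p over these primes is then bounded by the decrease of P.
    Step : (ℕ → ℚ) → ℕ → Set
    Step P y = ((¬ Prime (suc y) ⊎ χ (suc y) ≡ ψ (suc y)) × P (suc y) ≤ P y)
             ⊎ (Prime (suc y) × P (suc y) * ι (2 ℕ.+ y) ≡ P y * ι y)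

    module _ {P : ℕ → ℚ} (0≤P : ∀ y → 0ℚ ≤ P y) where

      -- For the prime p = `suc y`, the new value of `P` is (p - 1) / (p + 1) times the old one, so
      -- the drop is 2 / (p - 1) times the new value. Sums of 2 / p thereby become telescoping drops
      -- of `P`.
      decrease : ∀ {y} → P (suc y) * ι (2 ℕ.+ y) ≡ P y * ι y →
                 ι y * (P y - P (suc y)) ≡ ι 2 * P (suc y)
      decrease {y} eq = begin
        ι y * (P y - P (suc y))
          ≡⟨ solve 3 (λ n p q → n :* (p :- q) := p :* n :- q :* n) refl (ι y) (P y) (P (suc y)) ⟩
        P y * ι y - P (suc y) * ι y
          ≡⟨ cong (_- P (suc y) * ι y) eq ⟨
        P (suc y) * ι (2 ℕ.+ y) - P (suc y) * ι y
          ≡⟨ solve 2 (λ n q → q :* (con 1ℚ :+ (con 1ℚ :+ n)) :- q :* n := con (ι 2) :* q) refl (ι y) (P (suc y)) ⟩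
        ι 2 * P (suc y) ∎
        where open ≡-Reasoning

      P-step : ∀ {y} → Step P y → P (suc y) ≤ P y
      P-step (inj₁ (_ , P≤)) = P≤
      -- Here `ι y` is 0 and could not be cancelled, but 1 is not prime.
      P-step {zero}  (inj₂ (pr , _))  = contradiction pr ¬prime[1]
      P-step {suc y} (inj₂ (pr , eq)) = *-cancel (ι>0 y)
        (≤-from-diff (ι 2 * P (2 ℕ.+ y)) (ι≥0 2 ⊛ 0≤P (2 ℕ.+ y))
          (trans (solve 3 (λ n p q → n :* p := n :* q :+ n :* (p :- q)) refl (ι (suc y)) (P (suc y)) (P (2 ℕ.+ y)))
                 (cong (ι (suc y) * P (2 ℕ.+ y) +_) (decrease eq))))

      -- The change at a prime p is at most 2 x / p; after multiplication by the new value of `P`,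
      -- `decrease` bounds it by the drop of `P`.
      weighted-step : ∀ {y} → Step P y → ∀ x →
                      P (suc y) * ∣ H (suc y) x - H y x ∣ ≤ ι 2 * ι x * (P y - P (suc y))
      weighted-step {y} (inj₁ (same , P≤)) x = begin
        P (suc y) * ∣ H (suc y) x - H y x ∣  ≡⟨ cong (λ z → P (suc y) * ∣ z - H y x ∣) (H-skip y same x) ⟩
        P (suc y) * ∣ H y x - H y x ∣        ≡⟨ cong (λ z → P (suc y) * ∣ z ∣) (+-inverseʳ (H y x)) ⟩
        P (suc y) * 0ℚ                       ≡⟨ *-zeroʳ (P (suc y)) ⟩
        0ℚ                                   ≤⟨ (ι≥0 2 ⊛ ι≥0 x) ⊛ 0≤-diff P≤ ⟩
        ι 2 * ι x * (P y - P (suc y))        ∎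
        where open ≤-Reasoning
      weighted-step {zero}  (inj₂ (pr , _))  x = contradiction pr ¬prime[1]
      weighted-step {suc n} (inj₂ (pr , eq)) x = *-cancel (ι>0 n) (begin
        ι y * (P (suc y) * ∣Δ∣)
          ≤⟨ ≤-from-diff (P (suc y) * ∣Δ∣) (0≤P (suc y) ⊛ 0≤∣p∣ (H (suc y) x - H y x))
               (solve 3 (λ y p d → p :* ((con 1ℚ :+ y) :* d) := y :* (p :* d) :+ p :* d) refl (ι y) (P (suc y)) ∣Δ∣) ⟩
        P (suc y) * (ι (suc y) * ∣Δ∣)
          ≤⟨ *-monoʳ (0≤P (suc y)) (∣H-step∣ y pr x) ⟩
        P (suc y) * (ι 2 * ι x)
          -- A factor of 2 is given away here.
          ≤⟨ ≤-from-diff _ (0≤P (suc y) ⊛ (ι≥0 2 ⊛ ι≥0 x))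
               (solve 2 (λ p x → con (ι 2) :* x :* (con (ι 2) :* p) := p :* (con (ι 2) :* x) :+ p :* (con (ι 2) :* x))
                 refl (P (suc y)) (ι x)) ⟩
        ι 2 * ι x * (ι 2 * P (suc y))
          ≡⟨ cong (ι 2 * ι x *_) (decrease eq) ⟨
        ι 2 * ι x * (ι y * (P y - P (suc y)))
          ≡⟨ solve 4 (λ x y p q → con (ι 2) :* x :* (y :* (p :- q)) := y :* (con (ι 2) :* x :* (p :- q))) refl
               (ι x) (ι y) (P y) (P (suc y)) ⟩
        ι y * (ι 2 * ι x * (P y - P (suc y))) ∎)
        where
        open ≤-Reasoning
        y = suc n
        ∣Δ∣ = ∣ H (suc y) x - H y x ∣

      -- The drops of `P` telescope, and since `P` decreases, its last value `P z` may serve as the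
      -- weight of every step.
      compare : ∀ {y z} → y ℕ.≤′ z → (∀ {t} → y ℕ.≤ t → t ℕ.< z → Step P t) → ∀ x →
                P z * ∣ H z x - H y x ∣ ≤ ι 2 * ι x * (P y - P z)
      compare {y} ℕ.≤′-refl steps x = ≤-reflexive (begin
        P y * ∣ H y x - H y x ∣    ≡⟨ cong (λ z → P y * ∣ z ∣) (+-inverseʳ (H y x)) ⟩
        P y * 0ℚ                   ≡⟨ solve 2 (λ p x → p :* con 0ℚ := con (ι 2) :* x :* (p :- p)) refl (P y) (ι x) ⟩
        ι 2 * ι x * (P y - P y)    ∎)
        where open ≡-Reasoning
      compare {y} {suc z} (ℕ.≤′-step y≤z) steps x = begin
        P (suc z) * ∣ H (suc z) x - H y x ∣
          ≡⟨ cong (λ t → P (suc z) * ∣ t ∣)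
               (solve 3 (λ a b c → a :- c := (a :- b) :+ (b :- c)) refl (H (suc z) x) (H z x) (H y x)) ⟩
        P (suc z) * ∣ (H (suc z) x - H z x) + (H z x - H y x) ∣
          ≤⟨ *-monoʳ (0≤P (suc z)) (∣p+q∣≤∣p∣+∣q∣ (H (suc z) x - H z x) (H z x - H y x)) ⟩
        P (suc z) * (∣ H (suc z) x - H z x ∣ + ∣ H z x - H y x ∣)
          ≡⟨ solve 3 (λ p a b → p :* (a :+ b) := p :* a :+ b :* p) refl (P (suc z)) _ _ ⟩
        P (suc z) * ∣ H (suc z) x - H z x ∣ + ∣ H z x - H y x ∣ * P (suc z)
          ≤⟨ +-mono-≤ (weighted-step stepz x) (*-monoʳ (0≤∣p∣ (H z x - H y x)) (P-step stepz)) ⟩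
        ι 2 * ι x * (P z - P (suc z)) + ∣ H z x - H y x ∣ * P z
          ≡⟨ cong (ι 2 * ι x * (P z - P (suc z)) +_) (*-comm ∣ H z x - H y x ∣ (P z)) ⟩
        ι 2 * ι x * (P z - P (suc z)) + P z * ∣ H z x - H y x ∣
          ≤⟨ +-monoʳ-≤ (ι 2 * ι x * (P z - P (suc z)))
               (compare y≤z (λ y≤t t<z → steps y≤t (ℕ.m≤n⇒m≤1+n t<z)) x) ⟩
        ι 2 * ι x * (P z - P (suc z)) + ι 2 * ι x * (P y - P z)
          ≡⟨ solve 4 (λ x p q r → con (ι 2) :* x :* (q :- r) :+ con (ι 2) :* x :* (p :- q) := con (ι 2) :* x :* (p :- r))
               refl (ι x) (P y) (P z) (P (suc z)) ⟩
        ι 2 * ι x * (P y - P (suc z)) ∎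
        where
        open ≤-Reasoning
        stepz : Step P z
        stepz = steps (ℕ.≤′⇒≤ y≤z) ℕ.≤-refl

-- Exponential bounds

3/2 : ℚ
3/2 = ℤ.+ 3 / 2

_^^_ : ℚ → ℕ → ℚ
q ^^ zero  = 1ℚ
q ^^ suc n = q * q ^^ n

1≤^^ : ∀ {q} → 1ℚ ≤ q → ∀ n → 1ℚ ≤ q ^^ n
1≤^^         1≤q zero    = ≤-refl
1≤^^ {q} 1≤q (suc n) = begin
  1ℚ            ≤⟨ 1≤q ⟩
  q             ≡⟨ *-identityʳ q ⟨
  q * 1ℚ        ≤⟨ *-monoʳ (≤-trans 0≤1 1≤q) (1≤^^ 1≤q n) ⟩
  q * q ^^ n    ∎
  where open ≤-Reasoning

ι-^ : ∀ m n → ι (m ℕ.^ n) ≡ ι m ^^ n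
ι-^ m zero    = +-identityʳ 1ℚ
ι-^ m (suc n) = trans (ι-* m (m ℕ.^ n)) (cong (ι m *_) (ι-^ m n))

-- For x of size 2 to the power `m` this is sublinear in x, at the price of a factor exponential in
-- `y`.
B : ℕ → ℕ → ℚ
B y m = ι 11 ^^ y * 3/2 ^^ m

1≤11 : 1ℚ ≤ ι 11
1≤11 = from-yes (1ℚ ≤? ι 11)

1≤3/2 : 1ℚ ≤ 3/2
1≤3/2 = from-yes (1ℚ ≤? 3/2)

1≤B : ∀ y m → 1ℚ ≤ B y m
1≤B y m = begin
  1ℚ              ≤⟨ 1≤^^ 1≤11 y ⟩
  ι 11 ^^ y       ≡⟨ *-identityʳ _ ⟨
  ι 11 ^^ y * 1ℚ  ≤⟨ *-monoʳ (≤-trans 0≤1 (1≤^^ 1≤11 y)) (1≤^^ 1≤3/2 m) ⟩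
  B y m           ∎
  where open ≤-Reasoning

0≤B : ∀ y m → 0ℚ ≤ B y m
0≤B y m = ≤-trans 0≤1 (1≤B y m)

-- The bound is arranged so that 3/2 + 1 + 11 + 2 ≤ 11 * 3/2.
growth : (D : ℕ → ℕ → ℚ) → (∀ y → D y 0 ≡ 0ℚ) → (∀ x → ∣ D 0 x ∣ ≤ 1ℚ) →
         (∀ y → (∀ x → D (suc y) x ≡ D y x) ⊎
                (Prime (suc y) × (∀ x → let k = x ℕ./ suc y in
                  ∣ D (suc y) x ∣ ≤ ∣ D y x ∣ + ∣ D y k ∣ + ∣ D (suc y) k ∣ + ι 2))) →
         ∀ y m x → x ℕ.< 2 ℕ.^ m → ∣ D y x ∣ ≤ B y m
growth D D-0 D0 step zero    m       x x< = ≤-trans (D0 x) (1≤B zero m)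
growth D D-0 D0 step (suc y) zero    zero x< =
  ≤-trans (≤-reflexive (cong ∣_∣ (D-0 (suc y)))) (0≤B (suc y) zero)
growth D D-0 D0 step (suc y) zero    (suc x) (s≤s ())
growth D D-0 D0 step (suc y) (suc m) x x< with step y
... | inj₁ same = begin
  ∣ D (suc y) x ∣  ≡⟨ cong ∣_∣ (same x) ⟩
  ∣ D y x ∣        ≤⟨ growth D D-0 D0 step y (suc m) x x< ⟩
  B y (suc m)      ≤⟨ ≤-from-diff (ι 10 * B y (suc m)) (ι≥0 10 ⊛ 0≤B y (suc m))
                       (solve 2 (λ a b → con (ι 11) :* a :* b := a :* b :+ con (ι 10) :* (a :* b))
                         refl (ι 11 ^^ y) (3/2 ^^ suc m)) ⟩
  B (suc y) (suc m) ∎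
  where open ≤-Reasoning
... | inj₂ (pr , bound) = begin
  ∣ D (suc y) x ∣
    ≤⟨ bound x ⟩
  ∣ D y x ∣ + ∣ D y k ∣ + ∣ D (suc y) k ∣ + ι 2
    ≤⟨ +-monoˡ-≤ (ι 2) (+-mono-≤ (+-mono-≤ (growth D D-0 D0 step y (suc m) x x<)
                                           (growth D D-0 D0 step y m k k<))
                                 (growth D D-0 D0 step (suc y) m k k<)) ⟩
  B y (suc m) + B y m + B (suc y) m + ι 2
    ≤⟨ ≤-from-diff (B y m + (B y m - 1ℚ) + (B y m - 1ℚ))
         (0≤B y m ⊕ 0≤-diff (1≤B y m) ⊕ 0≤-diff (1≤B y m))
         (solve 2 (λ a b → con (ι 11) :* a :* (con 3/2 :* b) :=
             a :* (con 3/2 :* b) :+ a :* b :+ con (ι 11) :* a :* b :+ con (ι 2)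
                 :+ (a :* b :+ (a :* b :- con 1ℚ) :+ (a :* b :- con 1ℚ))) refl (ι 11 ^^ y) (3/2 ^^ m)) ⟩
  B (suc y) (suc m) ∎
  where
  open ≤-Reasoning
  k = x ℕ./ suc y
  2≤ : 2 ℕ.≤ suc y
  2≤ = ℕ.nonTrivial⇒n>1 (suc y) {{prime⇒nonTrivial pr}}
  -- Division by a prime at least halves `x`, so the exponent falls by one and the recursion
  -- terminates.
  k< : k ℕ.< 2 ℕ.^ m
  k< = m<n*o⇒m/o<n (ℕ.<-≤-trans x< (ℕ.≤-trans (ℕ.*-monoˡ-≤ (2 ℕ.^ m) 2≤)
    (ℕ.≤-reflexive (ℕ.*-comm (suc y) (2 ℕ.^ m)))))

-- Opaque, because Agda would unfold this power into exponentially many additions.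
opaque
  X : ℕ → ℕ
  X y = 2 ℕ.^ (11 ℕ.* suc y)

  X≡ : ∀ y → X y ≡ 2 ℕ.^ (11 ℕ.* suc y)
  X≡ y = refl

n<2^n : ∀ n → n ℕ.< 2 ℕ.^ n
n<2^n zero    = s≤s z≤n
n<2^n (suc n) = ℕ.≤-trans (ℕ.+-mono-≤ (ℕ.m^n>0 2 n) (n<2^n n))
                          (ℕ.≤-reflexive (cong (2 ℕ.^ n ℕ.+_) (sym (ℕ.+-identityʳ (2 ℕ.^ n)))))

y<X : ∀ y → y ℕ.< X y
y<X y = ℕ.≤-trans (ℕ.m≤n*m (suc y) 11)
  (ℕ.≤-trans (ℕ.<⇒≤ (n<2^n (11 ℕ.* suc y))) (ℕ.≤-reflexive (sym (X≡ y))))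

between-powers : ∀ x → ∃[ m ] (2 ℕ.^ m ℕ.≤ suc x × suc x ℕ.< 2 ℕ.^ suc m)
between-powers zero = 0 , s≤s z≤n , s≤s (s≤s z≤n)
between-powers (suc x) with between-powers x
... | m , lower , upper with ℕ.m≤n⇒m<n∨m≡n upper
...   | inj₁ upper′ = m , ℕ.m≤n⇒m≤1+n lower , upper′
...   | inj₂ eq     = suc m , ℕ.≤-reflexive (sym eq) ,
  ℕ.≤-<-trans (ℕ.≤-reflexive eq) (ℕ.^-monoʳ-< 2 (s≤s (s≤s z≤n)) (ℕ.n<1+n (suc m)))

^^-+ : ∀ q m n → q ^^ (m ℕ.+ n) ≡ q ^^ m * q ^^ n
^^-+ q zero    n = sym (*-identityˡ _)
^^-+ q (suc m) n = trans (cong (q *_) (^^-+ q m n)) (sym (*-assoc q _ _))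

-- Raising `y` by one multiplies the left side by at most 22 (3/2)^11, namely 11 from the base of
-- `B`, 2 from the last factor and (3/2)^11 from the exponent; the right side gains 2^11. The
-- exponent 11 is the least n with 22 (3/2)^n at most 2^n.
B-small : ∀ y → ι 2 * B y (11 ℕ.* suc y) * ι (suc y) ≤ ι 2 ^^ (11 ℕ.* suc y)
B-small zero    = from-yes (ι 2 * B 0 11 * ι 1 ≤? ι 2 ^^ 11)
B-small (suc y) = begin
  ι 2 * B (suc y) (11 ℕ.* suc (suc y)) * ι (2 ℕ.+ y)
    ≡⟨ cong (λ z → ι 2 * (ι 11 * e * z) * ι (2 ℕ.+ y)) (split 3/2) ⟩
  ι 2 * (ι 11 * e * (3/2 ^^ 11 * h)) * ι (2 ℕ.+ y)
    ≤⟨ ≤-from-diff _ ((((ι≥0 2 ⊛ ι≥0 11) ⊛ 0≤B y N) ⊛ from-yes (0ℚ ≤? 3/2 ^^ 11)) ⊛ ι≥0 y)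
         (solve 3 (λ e h n → con (ι 22 * 3/2 ^^ 11) :* (con (ι 2) :* (e :* h) :* (con 1ℚ :+ n)) :=
            con (ι 2) :* (con (ι 11) :* e :* (con (3/2 ^^ 11) :* h)) :* (con 1ℚ :+ (con 1ℚ :+ n))
              :+ con (ι 2) :* con (ι 11) :* (e :* h) :* con (3/2 ^^ 11) :* n) refl e h (ι y)) ⟩
  (ι 22 * 3/2 ^^ 11) * (ι 2 * B y N * ι (suc y))
    ≤⟨ *-monoʳ (from-yes (0ℚ ≤? ι 22 * 3/2 ^^ 11)) (B-small y) ⟩
  (ι 22 * 3/2 ^^ 11) * ι 2 ^^ N
    ≡⟨ *-comm _ (ι 2 ^^ N) ⟩
  ι 2 ^^ N * (ι 22 * 3/2 ^^ 11)
    ≤⟨ *-monoʳ (≤-trans 0≤1 (1≤^^ (from-yes (1ℚ ≤? ι 2)) N)) (from-yes (ι 22 * 3/2 ^^ 11 ≤? ι 2 ^^ 11)) ⟩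
  ι 2 ^^ N * ι 2 ^^ 11
    ≡⟨ trans (split (ι 2)) (*-comm _ (ι 2 ^^ N)) ⟨
  ι 2 ^^ (11 ℕ.* suc (suc y)) ∎
  where
  open ≤-Reasoning
  N = 11 ℕ.* suc y
  e = ι 11 ^^ y
  h = 3/2 ^^ N
  split : ∀ q → q ^^ (11 ℕ.* suc (suc y)) ≡ q ^^ 11 * q ^^ N
  split q = trans (cong (q ^^_) (ℕ.*-suc 11 (suc y))) (^^-+ q 11 N)

-- Each further doubling of `x` multiplies `B` by only 3/2, so the estimate at the starting exponent
-- `11 * suc y` persists.
X-large : ∀ y x → X y ℕ.≤ x → ∃[ m ] (x ℕ.< 2 ℕ.^ m × B y m * ι (suc y) ≤ ι x)
X-large y zero X≤ = contradiction (ℕ.≤-trans (y<X y) X≤) λ ()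
X-large y (suc x) X≤ with between-powers x
... | m , lower , upper = suc m , upper , bound N≤m
  where
  N = 11 ℕ.* suc y
  N≤m : N ℕ.≤ m
  N≤m = ℕ.≮⇒≥ λ m<N → ℕ.<-irrefl refl
    (ℕ.<-≤-trans upper (ℕ.≤-trans (ℕ.^-monoʳ-≤ 2 m<N) (ℕ.≤-trans (ℕ.≤-reflexive (sym (X≡ y))) X≤)))

  -- The factor `ι 2` in front pays for the later passage from `B y m` to `B y (suc m)`.
  doubled : ∀ {m} → N ℕ.≤′ m → ι 2 * B y m * ι (suc y) ≤ ι 2 ^^ m
  doubled ℕ.≤′-refl = B-small y
  doubled {suc m} (ℕ.≤′-step r) = begin
    ι 2 * B y (suc m) * ι (suc y)
      ≤⟨ ≤-from-diff (ι 1 * B y m * ι (suc y)) (ι≥0 1 ⊛ 0≤B y m ⊛ ι≥0 (suc y))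
           (solve 3 (λ e h n → con (ι 2) :* (con (ι 2) :* (e :* h) :* n) :=
              con (ι 2) :* (e :* (con 3/2 :* h)) :* n :+ con (ι 1) :* (e :* h) :* n)
              refl (ι 11 ^^ y) (3/2 ^^ m) (ι (suc y))) ⟩
    ι 2 * (ι 2 * B y m * ι (suc y))
      ≤⟨ *-monoʳ (ι≥0 2) (doubled r) ⟩
    ι 2 * ι 2 ^^ m ∎
    where open ≤-Reasoning

  bound : N ℕ.≤ m → B y (suc m) * ι (suc y) ≤ ι (suc x)
  bound N≤m = begin
    B y (suc m) * ι (suc y)
      ≤⟨ ≤-from-diff (½ * (B y m * ι (suc y))) (from-yes (0ℚ ≤? ½) ⊛ (0≤B y m ⊛ ι≥0 (suc y)))
           (solve 3 (λ e h n → con (ι 2) :* (e :* h) :* n :=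
              e :* (con 3/2 :* h) :* n :+ con ½ :* (e :* h :* n))
              refl (ι 11 ^^ y) (3/2 ^^ m) (ι (suc y))) ⟩
    ι 2 * B y m * ι (suc y)  ≤⟨ doubled (ℕ.≤⇒≤′ N≤m) ⟩
    ι 2 ^^ m                 ≡⟨ ι-^ 2 m ⟨
    ι (2 ℕ.^ m)              ≤⟨ ι-mono lower ⟩
    ι (suc x)                ∎
    where open ≤-Reasoning

-- Counting integers without large prime factors

-- `splice one nil y` extends to the indicator of the integers without prime factors above `y`, and
-- `H one nil y x` counts these up to `x`.
one nil : ℕ → ℚ
one _ = 1ℚ
nil _ = 0ℚ

∣one∣≤1 : ∀ q → ∣ one q ∣ ≤ 1ℚ
∣one∣≤1 _ = ≤-refl

∣nil∣≤1 : ∀ q → ∣ nil q ∣ ≤ 1ℚ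
∣nil∣≤1 _ = 0≤1

-- With Ψ(x, y) for the count, a prime p gives Ψ(x, p) = Ψ(x, p - 1) + Ψ(x / p, p), a recurrence of
-- the shape that `growth` bounds.
smooth-bound : ∀ y m x → x ℕ.< 2 ℕ.^ m → ∣ H one nil y x ∣ ≤ B y m
smooth-bound = growth (H one nil) (λ _ → refl) base step
  where
  base : ∀ x → ∣ H one nil 0 x ∣ ≤ 1ℚ
  base zero    = 0≤1
  base (suc x) = ≤-reflexive (cong ∣_∣ (trans (H-0 one nil (suc x)) (F-0 x)))
  step : ∀ y → _
  step y with prime? (suc y)
  ... | no ¬pr = inj₁ (H-skip one nil y (inj₁ ¬pr))
  ... | yes pr = inj₂ (pr , λ x → let k = x ℕ./ suc y ; h = H one nil in begin
    ∣ h (suc y) x ∣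
      ≡⟨ cong ∣_∣ (H-step one nil y pr x) ⟩
    ∣ h y x + (1ℚ * h (suc y) k - 0ℚ * h y k) ∣
      ≡⟨ cong ∣_∣ (solve 3 (λ a b c → a :+ (con 1ℚ :* b :- con 0ℚ :* c) := a :+ b)
                    refl (h y x) (h (suc y) k) (h y k)) ⟩
    ∣ h y x + h (suc y) k ∣
      ≤⟨ ∣p+q∣≤∣p∣+∣q∣ (h y x) (h (suc y) k) ⟩
    ∣ h y x ∣ + ∣ h (suc y) k ∣
      ≤⟨ ≤-from-diff (∣ h y k ∣ + ι 2) (0≤∣p∣ (h y k) ⊕ ι≥0 2)
           (solve 4 (λ a b c d → a :+ c :+ b :+ d := a :+ b :+ (c :+ d)) refl
             (∣ h y x ∣) (∣ h (suc y) k ∣) (∣ h y k ∣) (ι 2)) ⟩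
    ∣ h y x ∣ + ∣ h y k ∣ + ∣ h (suc y) k ∣ + ι 2 ∎)
    where open ≤-Reasoning

-- Since `b` is at most a quarter of `z`, `g` is at least 3/4 of `z`; then (3/4) q ≤ 2 (p - q),
-- which is 11 q ≤ 8 p.
decay-arith : ∀ {p q z g b} → 0ℚ ≤ q → q * g ≤ ι 2 * z * (p - q) → ι 4 * b ≤ z → z - b ≤ g →
              z * (ι 11 * q) ≤ z * (ι 8 * p)
decay-arith {p} {q} {z} {g} {b} 0≤q weighted 4b≤z gap = ≤-from-diff _
  (ι≥0 4 ⊛ 0≤-diff weighted ⊕ 0≤q ⊛ (ι≥0 4 ⊛ 0≤-diff gap ⊕ 0≤-diff 4b≤z))
  (solve 5 (λ p q z g b → z :* (con (ι 8) :* p) :=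
       z :* (con (ι 11) :* q) :+ (con (ι 4) :* (con (ι 2) :* z :* (p :- q) :- q :* g)
         :+ q :* (con (ι 4) :* (g :- (z :- b)) :+ (z :- con (ι 4) :* b))))
     refl p q z g b)

-- Since almost no n ≤ z has all its prime factors below y, the sum of 1 / p over y < p ≤ z is bounded below.
decay : ∀ {P y z} → (∀ t → 0ℚ ≤ P t) → 3 ℕ.≤ y → X y ℕ.≤ z →
        (∀ {t} → y ℕ.≤ t → t ℕ.< z → Step one nil ∣one∣≤1 ∣nil∣≤1 P t) →
        ι 11 * P z ≤ ι 8 * P y
decay {P} {y} {z} 0≤P 3≤y X≤ steps = go (X-large y z X≤)
  where
  open ≤-Reasoning
  y<z : y ℕ.< z
  y<z = ℕ.<-≤-trans (y<X y) X≤
  go : ∃[ m ] (z ℕ.< 2 ℕ.^ m × B y m * ι (suc y) ≤ ι z) → ι 11 * P z ≤ ι 8 * P y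
  go (m , z< , small) = *-cancel {ι z} (ι-pos y<z) (decay-arith {P y} (0≤P z) weighted 4b≤z gap)
    where
    b = B y m
    h = H one nil y z
    g = ∣ H one nil z z - h ∣
    weighted : P z * g ≤ ι 2 * ι z * (P y - P z)
    weighted = compare one nil ∣one∣≤1 ∣nil∣≤1 0≤P (ℕ.≤⇒≤′ (ℕ.<⇒≤ y<z)) steps z
    4b≤z : ι 4 * b ≤ ι z
    4b≤z = begin
      ι 4 * b        ≡⟨ *-comm (ι 4) b ⟩
      b * ι 4        ≤⟨ *-monoʳ (0≤B y m) (ι-mono {4} {suc y} (s≤s 3≤y)) ⟩
      b * ι (suc y)  ≤⟨ small ⟩
      ι z            ∎
    -- No integer up to `z` has a prime factor above `z`, so `H one nil z z` counts all of them,
    -- while `h` counts at most `b`.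
    gap : ι z - b ≤ g
    gap = begin
      ι z - b              ≤⟨ +-monoʳ-≤ (ι z) (neg-antimono-≤ (≤-trans (x≤∣x∣ h) (smooth-bound y m z z<))) ⟩
      ι z - h              ≡⟨ cong (_- h) (trans (H-all one nil (ℕ.≤-refl {z})) (F-1 z)) ⟨
      H one nil z z - h    ≤⟨ x≤∣x∣ _ ⟩
      g                    ∎

-- The function λ_A as a rational-valued completely multiplicative function

sign : PrimeSet → ℕ → ℚ
sign A q with PrimeSet.member? A q
... | yes _ = - 1ℚ
... | no  _ = 1ℚ

sign-∈ : ∀ A {q} → PrimeSet.member A q → sign A q ≡ - 1ℚ
sign-∈ A {q} q∈ with PrimeSet.member? A q
... | yes _  = refl
... | no  q∉ = contradiction q∈ q∉

sign-∉ : ∀ A {q} → ¬ PrimeSet.member A q → sign A q ≡ 1ℚ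
sign-∉ A {q} q∉ with PrimeSet.member? A q
... | yes q∈ = contradiction q∈ q∉
... | no  _  = refl

∣sign∣≤1 : ∀ A q → ∣ sign A q ∣ ≤ 1ℚ
∣sign∣≤1 A q with PrimeSet.member? A q
... | yes _ = ≤-refl
... | no  _ = ≤-refl

/1-neg : ∀ i → ℤ.-1ℤ ℤ.* i / 1 ≡ - 1ℚ * (i / 1)
/1-neg i = begin
  ℤ.-1ℤ ℤ.* i / 1                  ≡⟨ cong (_/ 1) (ℤ.-1*i≡-i i) ⟩
  ℤ.- i / 1                        ≡⟨ solve 2 (λ a b → a := (b :+ a) :+ con (- 1ℚ) :* b) refl (ℤ.- i / 1) (i / 1) ⟩
  i / 1 + ℤ.- i / 1 + - 1ℚ * (i / 1)  ≡⟨ cong (_+ - 1ℚ * (i / 1)) (/1-+ i (ℤ.- i)) ⟨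
  (i ℤ.+ ℤ.- i) / 1 + - 1ℚ * (i / 1)  ≡⟨ cong (λ z → z / 1 + - 1ℚ * (i / 1)) (ℤ.+-inverseʳ i) ⟩
  0ℚ + - 1ℚ * (i / 1)              ≡⟨ +-identityˡ _ ⟩
  - 1ℚ * (i / 1)                   ∎
  where open ≡-Reasoning

value-sign : ∀ A ps → ℤ.-1ℤ ℤ.^ length (filter (PrimeSet.member? A) ps) / 1 ≡ value (sign A) ps
value-sign A [] = refl
value-sign A (p ∷ ps) with PrimeSet.member? A p
... | yes _ = trans (/1-neg (ℤ.-1ℤ ℤ.^ length (filter (PrimeSet.member? A) ps))) (cong (- 1ℚ *_) (value-sign A ps))
... | no  _ = trans (value-sign A ps) (sym (*-identityˡ _))

summatory≡F : ∀ A n → summatory A n / 1 ≡ F (sign A) n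
summatory≡F A zero    = refl
summatory≡F A (suc n) = trans (/1-+ (summatory A n) (liouville A (suc n)))
  (cong₂ _+_ (summatory≡F A n) (value-sign A (factors (factorise (suc n)))))

average*n : ∀ A n → average A (suc n) * ι (suc n) ≡ F (sign A) (suc n)
average*n A n = trans (/-*-cancel (summatory A (suc n)) n) (summatory≡F A (suc n))

-- The greedy set of primes

module Greedy (θ : ℕ → ℚ) where

  -- With p = `suc n` this is (p - 1) / (p + 1), the factor of p in the product for R_A.
  ratio : ℕ → ℚ
  ratio n = ℤ.+ n / (2 ℕ.+ n)

  ratio-* : ∀ p n → p * ratio n * ι (2 ℕ.+ n) ≡ p * ι n
  ratio-* p n = trans (*-assoc p (ratio n) _) (cong (p *_) (trans (/-*-cancel (ℤ.+ n) (suc n)) (sym (ι≡/1 n))))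

  -- The comparison is between rationals, hence decidable, as membership in a `PrimeSet` must be.
  Accept : ℕ → ℚ → Set
  Accept n p = Prime (suc n) × θ (suc n) ≤ p * ratio n

  -- Opaque, so that `P` at a concrete argument such as 16 does not evaluate primality tests and
  -- fractions.
  opaque
    accept? : ∀ n p → Dec (Accept n p)
    accept? n p = prime? (suc n) ×-dec (θ (suc n) ≤? p * ratio n)

  next : ℕ → ℚ → ℚ
  next n p with accept? n p
  ... | yes _ = p * ratio n
  ... | no  _ = p

  P : ℕ → ℚ
  P zero    = 1ℚ
  P (suc n) = next n (P n)

  Member : ℕ → Set
  Member zero    = ⊥
  Member (suc n) = Accept n (P n)

  A : PrimeSet
  A = record
    { member  = Member
    ; member? = λ { zero → no λ () ; (suc n) → accept? n (P n) }
    ; primes  = λ { {suc n} (pr , _) → pr }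
    }

  next-cases : ∀ n p → (Accept n p × next n p ≡ p * ratio n) ⊎ (¬ Accept n p × next n p ≡ p)
  next-cases n p with accept? n p
  ... | yes a = inj₁ (a , refl)
  ... | no ¬a = inj₂ (¬a , refl)

  P-cases : ∀ n → (Accept n (P n) × P (suc n) * ι (2 ℕ.+ n) ≡ P n * ι n)
                ⊎ (¬ Accept n (P n) × P (suc n) ≡ P n)
  P-cases n = Sum.map₁
    (λ (a , eq) → a , trans (cong (_* ι (2 ℕ.+ n)) eq) (ratio-* (P n) n)) (next-cases n (P n))

  0≤P : ∀ n → 0ℚ ≤ P n
  0≤P zero    = 0≤1
  0≤P (suc n) = *-cancel (ι>0 (suc n))
    (subst₂ _≤_ (sym (*-zeroʳ (ι (2 ℕ.+ n)))) (*-comm (P (suc n)) (ι (2 ℕ.+ n))) scaled)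
    where
    scaled : 0ℚ ≤ P (suc n) * ι (2 ℕ.+ n)
    scaled = [ (λ (_ , eq) → subst (0ℚ ≤_) (sym eq) (0≤P n ⊛ ι≥0 n))
             , (λ (_ , eq) → subst (λ z → 0ℚ ≤ z * ι (2 ℕ.+ n)) (sym eq) (0≤P n ⊛ ι≥0 (2 ℕ.+ n))) ]′ (P-cases n)

  steps : ∀ n → Step (sign A) one (∣sign∣≤1 A) ∣one∣≤1 P n
  steps n = [ (λ (a , eq) → inj₂ (proj₁ a , eq))
            , (λ (¬a , eq) → inj₁ (inj₂ (sign-∉ A {suc n} ¬a) , ≤-reflexive eq)) ]′ (P-cases n)

  P-antitone : ∀ {m n} → m ℕ.≤′ n → P n ≤ P m
  P-antitone ℕ.≤′-refl               = ≤-refl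
  P-antitone {n = suc n} (ℕ.≤′-step r) =
    ≤-trans (P-step (sign A) one (∣sign∣≤1 A) ∣one∣≤1 0≤P (steps n)) (P-antitone r)

  P≤1 : ∀ n → P n ≤ 1ℚ
  P≤1 n = P-antitone {0} {n} (ℕ.≤⇒≤′ z≤n)

  -- An accepted prime keeps `P` above the threshold by the rule of acceptance; otherwise `P` is
  -- unchanged while the threshold does not rise.
  θ≤P : (∀ n → θ (suc n) ≤ θ n) → θ 0 ≤ 1ℚ → ∀ n → θ n ≤ P n
  θ≤P anti θ0 zero    = θ0
  θ≤P anti θ0 (suc n) =
    [ (λ ((_ , θ≤) , eq) → subst (θ (suc n) ≤_) (sym eq) θ≤)
    , (λ (_ , eq) → subst (θ (suc n) ≤_) (sym eq) (≤-trans (anti n) (θ≤P anti θ0 n))) ]′ (next-cases n (P n))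

  -- Bounds the effect of the primes between `y` and `x`: at `z = x` in `compare` every relevant
  -- prime already carries its sign.
  tail-bound : ∀ {y x} → y ℕ.≤ x →
               P x * ∣ F (sign A) x - H (sign A) one y x ∣ ≤ ι 2 * ι x * (P y - P x)
  tail-bound {y} {x} y≤x = subst (λ z → P x * ∣ z - H (sign A) one y x ∣ ≤ ι 2 * ι x * (P y - P x))
    (H-all (sign A) one (ℕ.≤-refl {x}))
    (compare (sign A) one (∣sign∣≤1 A) ∣one∣≤1 0≤P (ℕ.≤⇒≤′ y≤x) (λ {t} _ _ → steps t) x)

  -- The error of the main term when only the primes up to `y` carry their signs.
  D : ℕ → ℕ → ℚ
  D y x = H (sign A) one y x - P y * ι x

  -- Write p, q for the values of `P` before and after an accepted prime. The factor (n - 1) / (n +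
  -- 1) at a prime n gives (p - q) n = p + q, so the main terms in `H-step` cancel up to (p - q)
  -- times the remainder of `x` modulo n. This is at most p + q, hence at most 2.
  D-step : ∀ y → (∀ x → D (suc y) x ≡ D y x) ⊎
                 (Prime (suc y) × (∀ x → let k = x ℕ./ suc y in
                   ∣ D (suc y) x ∣ ≤ ∣ D y x ∣ + ∣ D y k ∣ + ∣ D (suc y) k ∣ + ι 2))
  D-step y = [ (λ (a , eq) → inj₂ (proj₁ a , bound a eq))
             , (λ (¬a , eq) → inj₁ λ x → cong₂ (λ h p → h - p * ι x)
                                 (H-skip (sign A) one y (inj₂ (sign-∉ A {suc y} ¬a)) x) eq) ]′ (P-cases y)
    where
    open ≤-Reasoning
    h = H (sign A) one
    bound : Accept y (P y) → P (suc y) * ι (2 ℕ.+ y) ≡ P y * ι y → ∀ x → let k = x ℕ./ suc y in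
            ∣ D (suc y) x ∣ ≤ ∣ D y x ∣ + ∣ D y k ∣ + ∣ D (suc y) k ∣ + ι 2
    bound a eq x = begin
      ∣ D (suc y) x ∣
        ≡⟨ cong ∣_∣ expand ⟩
      ∣ D y x - D y k - D (suc y) k + w ∣
        ≤⟨ ∣p+q∣≤∣p∣+∣q∣ (D y x - D y k - D (suc y) k) w ⟩
      ∣ D y x - D y k - D (suc y) k ∣ + ∣ w ∣
        ≤⟨ +-mono-≤ (≤-trans (∣p-q∣≤∣p∣+∣q∣ (D y x - D y k) (D (suc y) k))
                             (+-monoˡ-≤ (∣ D (suc y) k ∣) (∣p-q∣≤∣p∣+∣q∣ (D y x) (D y k))))
                    ∣w∣≤2 ⟩
      ∣ D y x ∣ + ∣ D y k ∣ + ∣ D (suc y) k ∣ + ι 2 ∎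
      where
      k = x ℕ./ suc y
      r = x ℕ.% suc y
      p = P y
      q = P (suc y)
      w = (p - q) * ι r
      q≤p : q ≤ p
      q≤p = P-antitone (ℕ.≤′-step ℕ.≤′-refl)

      telescoped : (p - q) * ι (suc y) ≡ p + q
      telescoped = begin-equality
        (p - q) * ι (suc y)
          ≡⟨ solve 3 (λ p q n → (p :- q) :* (con 1ℚ :+ n) :=
               p :* n :- q :* (con 1ℚ :+ (con 1ℚ :+ n)) :+ (p :+ q)) refl p q (ι y) ⟩
        p * ι y - q * ι (2 ℕ.+ y) + (p + q)  ≡⟨ cong (λ z → p * ι y - z + (p + q)) eq ⟩
        p * ι y - p * ι y + (p + q)          ≡⟨ cong (_+ (p + q)) (+-inverseʳ (p * ι y)) ⟩
        0ℚ + (p + q)                         ≡⟨ +-identityˡ (p + q) ⟩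
        p + q                                ∎

      ∣w∣≤2 : ∣ w ∣ ≤ ι 2
      ∣w∣≤2 = begin
        ∣ w ∣                ≡⟨ 0≤p⇒∣p∣≡p (0≤-diff q≤p ⊛ ι≥0 r) ⟩
        (p - q) * ι r        ≤⟨ *-monoʳ (0≤-diff q≤p) (ι-mono (ℕ.<⇒≤ (m%n<n x (suc y)))) ⟩
        (p - q) * ι (suc y)  ≡⟨ telescoped ⟩
        p + q                ≤⟨ +-mono-≤ (P≤1 y) (P≤1 (suc y)) ⟩
        ι 2                  ∎

      x≡ : ι x ≡ ι r + ι k * ι (suc y)
      x≡ = trans (cong ι (m≡m%n+[m/n]*n x (suc y)))
        (trans (ι-+ r (k ℕ.* suc y)) (cong (ι r +_) (ι-* k (suc y))))

      expand : D (suc y) x ≡ D y x - D y k - D (suc y) k + w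
      expand = begin-equality
        h (suc y) x - q * ι x
          ≡⟨ cong (_- q * ι x) (H-step (sign A) one y (proj₁ a) x) ⟩
        h y x + (sign A (suc y) * h (suc y) k - 1ℚ * h y k) - q * ι x
          ≡⟨ cong (λ z → h y x + (z * h (suc y) k - 1ℚ * h y k) - q * ι x) (sign-∈ A {suc y} a) ⟩
        h y x + (- 1ℚ * h (suc y) k - 1ℚ * h y k) - q * ι x
          ≡⟨ solve 7 (λ a b c p q x k →
               a :+ (con (- 1ℚ) :* b :- con 1ℚ :* c) :- q :* x :=
               (a :- p :* x) :- (c :- p :* k) :- (b :- q :* k) :+ ((p :- q) :* x :- (p :+ q) :* k))
               refl (h y x) (h (suc y) k) (h y k) p q (ι x) (ι k) ⟩
        D y x - D y k - D (suc y) k + ((p - q) * ι x - (p + q) * ι k)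
          ≡⟨ cong₂ (λ z s → D y x - D y k - D (suc y) k + ((p - q) * z - s * ι k)) x≡ (sym telescoped) ⟩
        D y x - D y k - D (suc y) k + ((p - q) * (ι r + ι k * ι (suc y)) - (p - q) * ι (suc y) * ι k)
          ≡⟨ cong (D y x - D y k - D (suc y) k +_)
               (solve 4 (λ d r k n → d :* (r :+ k :* n) :- d :* n :* k := d :* r)
                 refl (p - q) (ι r) (ι k) (ι (suc y))) ⟩
        D y x - D y k - D (suc y) k + w ∎

  D-bound : ∀ y m x → x ℕ.< 2 ℕ.^ m → ∣ D y x ∣ ≤ B y m
  D-bound = growth D (λ y → cong (λ z → 0ℚ - z) (*-zeroʳ (P y))) base D-step
    where
    base : ∀ x → ∣ D 0 x ∣ ≤ 1ℚ
    base x = ≤-trans (≤-reflexive (cong ∣_∣ (trans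
      (cong₂ _-_ (trans (H-0 (sign A) one x) (F-1 x)) (*-identityˡ (ι x))) (+-inverseʳ (ι x))))) 0≤1

  main-term : ∀ {y x} → X y ℕ.≤ x → ∣ D y x ∣ * ι (suc y) ≤ ι x
  main-term {y} {x} X≤ = go (X-large y x X≤)
    where
    go : ∃[ m ] (x ℕ.< 2 ℕ.^ m × B y m * ι (suc y) ≤ ι x) → ∣ D y x ∣ * ι (suc y) ≤ ι x
    go (m , x< , small) = ≤-trans
      (*-monoʳ-≤-nonNeg (ι (suc y)) {{nonNegative (ι≥0 (suc y))}} (D-bound y m x x<)) small

-- Thresholds converging to α

-- The numerator 2 matches the excess of (t + 2) / t over 1 at a rejected prime `suc t` with t ≥ 16
-- + k; the 16 keeps `u` at most 1/8.
u : ℕ → ℚ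
u k = ℤ.+ 2 / (16 ℕ.+ k)

u-* : ∀ k → u k * ι (16 ℕ.+ k) ≡ ι 2
u-* k = /-*-cancel (ℤ.+ 2) (15 ℕ.+ k)

0<u : ∀ k → 0ℚ < u k
0<u k = positive⁻¹ (u k) {{normalize-pos 2 (16 ℕ.+ k)}}

0≤u : ∀ k → 0ℚ ≤ u k
0≤u k = <⇒≤ (0<u k)

8u≤1 : ∀ k → ι 8 * u k ≤ 1ℚ
8u≤1 k = *-cancel (ι>0 1) (begin
  ι 2 * (ι 8 * u k)     ≡⟨ solve 1 (λ u → con (ι 2) :* (con (ι 8) :* u) := u :* con (ι 16)) refl (u k) ⟩
  u k * ι 16            ≤⟨ *-monoʳ (0≤u k) (ι-mono (ℕ.m≤m+n 16 k)) ⟩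
  u k * ι (16 ℕ.+ k)    ≡⟨ u-* k ⟩
  ι 2                   ≡⟨ *-identityʳ (ι 2) ⟨
  ι 2 * 1ℚ              ∎)
  where open ≤-Reasoning

u-diff : ∀ k → ι 2 * (u k - u (suc k)) ≡ u k * u (suc k)
u-diff k = begin
  ι 2 * (u k - u (suc k))
    ≡⟨ solve 3 (λ t u v → t :* (u :- v) := t :* u :- t :* v) refl (ι 2) (u k) (u (suc k)) ⟩
  ι 2 * u k - ι 2 * u (suc k)
    ≡⟨ cong₂ (λ s t → s * u k - t * u (suc k)) (u-* (suc k)) (u-* k) ⟨
  u (suc k) * ι (17 ℕ.+ k) * u k - u k * a * u (suc k)
    ≡⟨ solve 3 (λ u v a → v :* (con 1ℚ :+ a) :* u :- u :* a :* v := u :* v) refl (u k) (u (suc k)) a ⟩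
  u k * u (suc k) ∎
  where
  open ≡-Reasoning
  a = ι (16 ℕ.+ k)

-- By `u-diff` this is 8 times the drop of `u`; the product form makes its positivity immediate.
tolerance : ℕ → ℚ
tolerance k = ι 4 * (u k * u (suc k))

tolerance≡ : ∀ k → tolerance k ≡ ι 8 * (u k - u (suc k))
tolerance≡ k = trans (cong (ι 4 *_) (sym (u-diff k)))
  (solve 1 (λ d → con (ι 4) :* (con (ι 2) :* d) := con (ι 8) :* d) refl (u k - u (suc k)))

0<tolerance : ∀ k → 0ℚ < tolerance k
0<tolerance k = positive⁻¹ (tolerance k)
  {{pos*pos⇒pos (ι 4) (u k * u (suc k))
    {{pos*pos⇒pos (u k) {{positive (0<u k)}} (u (suc k)) {{positive (0<u (suc k))}}}}}}

u-antitone : ∀ k → u (suc k) ≤ u k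
u-antitone k = ≤-from-diff (½ * (u k * u (suc k))) (from-yes (0ℚ ≤? ½) ⊛ (0≤u k ⊛ 0≤u (suc k)))
  (trans (solve 2 (λ u v → u := v :+ con ½ :* (con (ι 2) :* (u :- v))) refl (u k) (u (suc k)))
         (cong (λ z → u (suc k) + ½ * z) (u-diff k)))

module Threshold (α : ℝ) where

  open ℝ α

  -- `M` makes the Cauchy moduli monotone, so that the sample at `M k` is comparable with all later
  -- samples.
  N M : ℕ → ℕ
  N k = proj₁ (cauchy (tolerance k) (0<tolerance k))
  M zero    = N zero
  M (suc k) = M k ℕ.⊔ N (suc k)

  N≤M : ∀ k → N k ℕ.≤ M k
  N≤M zero    = ℕ.≤-refl
  N≤M (suc k) = ℕ.m≤n⊔m (M k) (N (suc k))

  close : ∀ k {m} → M k ℕ.≤ m → ∣ seq (M k) - seq m ∣ ≤ tolerance k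
  close k M≤m = <⇒≤ (proj₂ (cauchy (tolerance k) (0<tolerance k)) _ _ (N≤M k) (ℕ.≤-trans (N≤M k) M≤m))

  close₁ : ∀ k {m} → M k ℕ.≤ m → seq (M k) ≤ seq m + tolerance k
  close₁ k {m} M≤m = ≤-from-diff (tolerance k - (seq (M k) - seq m))
    (0≤-diff (≤-trans (x≤∣x∣ (seq (M k) - seq m)) (close k M≤m)))
    (solve 3 (λ a b t → b :+ t := a :+ (t :- (a :- b))) refl (seq (M k)) (seq m) (tolerance k))

  close₂ : ∀ k {m} → M k ℕ.≤ m → seq m ≤ seq (M k) + tolerance k
  close₂ k {m} M≤m = ≤-from-diff (tolerance k - (- (seq (M k) - seq m)))
    (0≤-diff (≤-trans (-x≤∣x∣ (seq (M k) - seq m)) (close k M≤m)))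
    (solve 3 (λ a b t → a :+ t := b :+ (t :- (:- (a :- b)))) refl (seq (M k)) (seq m) (tolerance k))

  M-suc : ∀ k → M k ℕ.≤ M (suc k)
  M-suc k = ℕ.m≤m⊔n (M k) (N (suc k))

  -- The summand 8 u k absorbs the error of the k-th approximation to α, which makes c antitone, and
  -- is large compared with the decrease of u, which makes c decrease slowly even when α = 0.
  q c : ℕ → ℚ
  q k = 0ℚ ⊔ seq (M k)
  c k = 1ℚ ⊓ (q k + ι 8 * u k)

  0≤q : ∀ k → 0ℚ ≤ q k
  0≤q k = p≤p⊔q 0ℚ (seq (M k))

  seq≤q : ∀ k → seq (M k) ≤ q k
  seq≤q k = p≤q⊔p 0ℚ (seq (M k))

  c≤1 : ∀ k → c k ≤ 1ℚ
  c≤1 k = p⊓q≤p 1ℚ (q k + ι 8 * u k)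

  c≤q+8u : ∀ k → c k ≤ q k + ι 8 * u k
  c≤q+8u k = p⊓q≤q 1ℚ (q k + ι 8 * u k)

  q-lub : ∀ k {b} → 0ℚ ≤ b → seq (M k) ≤ b → q k ≤ b
  q-lub k = ⊔-lub

  q-step₁ : ∀ k → q (suc k) ≤ q k + tolerance k
  q-step₁ k = q-lub (suc k) (0≤q k ⊕ <⇒≤ (0<tolerance k))
    (≤-trans (close₂ k (M-suc k)) (+-monoˡ-≤ (tolerance k) (seq≤q k)))

  q-step₂ : ∀ k → q k ≤ q (suc k) + tolerance k
  q-step₂ k = q-lub k (0≤q (suc k) ⊕ <⇒≤ (0<tolerance k))
    (≤-trans (close₁ k (M-suc k)) (+-monoˡ-≤ (tolerance k) (seq≤q (suc k))))

  -- `q` rises by at most `tolerance k`, which is exactly the amount by which 8 u falls.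
  c-antitone : ∀ k → c (suc k) ≤ c k
  c-antitone k = ⊓-glb (c≤1 (suc k)) (begin
    c (suc k)                              ≤⟨ c≤q+8u (suc k) ⟩
    q (suc k) + ι 8 * u (suc k)            ≤⟨ +-monoˡ-≤ (ι 8 * u (suc k)) (q-step₁ k) ⟩
    q k + tolerance k + ι 8 * u (suc k)    ≡⟨ cong (λ z → q k + z + ι 8 * u (suc k)) (tolerance≡ k) ⟩
    q k + ι 8 * (u k - u (suc k)) + ι 8 * u (suc k)
      ≡⟨ solve 3 (λ q u v → q :+ con (ι 8) :* (u :- v) :+ con (ι 8) :* v := q :+ con (ι 8) :* u)
           refl (q k) (u k) (u (suc k)) ⟩
    q k + ι 8 * u k                        ∎)
    where open ≤-Reasoning

  c-elim : ∀ k {b} → b ≤ 1ℚ + u k → b ≤ (1ℚ + u k) * (q (suc k) + ι 8 * u (suc k)) →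
           b ≤ (1ℚ + u k) * c (suc k)
  c-elim k {b} b≤₁ b≤₂ =
    [ (λ eq → subst (λ z → b ≤ (1ℚ + u k) * z) (sym eq) (subst (b ≤_) (sym (*-identityʳ _)) b≤₁))
    , (λ eq → subst (λ z → b ≤ (1ℚ + u k) * z) (sym eq) b≤₂)
    ]′ (⊓-sel 1ℚ (q (suc k) + ι 8 * u (suc k)))

  0<c : ∀ k → 0ℚ < c k
  0<c k = [ (λ eq → subst (0ℚ <_) (sym eq) (*<* (ℤ.+<+ (s≤s z≤n))))
          , (λ eq → subst (0ℚ <_) (sym eq) (+-mono-≤-< (0≤q k) 0<8u)) ]′ (⊓-sel 1ℚ (q k + ι 8 * u k))
    where
    0<8u : 0ℚ < ι 8 * u k
    0<8u = positive⁻¹ (ι 8 * u k) {{pos*pos⇒pos (ι 8) (u k) {{positive (0<u k)}}}}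

  -- By `u-diff`, 8 u k + `tolerance k` equals (1 + u k) 8 u (k + 1); the constant 4 in `tolerance`
  -- is tuned to this.
  c-slow : ∀ k → c k ≤ (1ℚ + u k) * c (suc k)
  c-slow k = c-elim k
    (≤-trans (c≤1 k) (≤-from-diff (u k) (0≤u k) refl))
    (begin
      c k                                   ≤⟨ c≤q+8u k ⟩
      q k + ι 8 * u k                       ≤⟨ +-monoˡ-≤ (ι 8 * u k) (q-step₂ k) ⟩
      q (suc k) + tolerance k + ι 8 * u k
        ≤⟨ ≤-from-diff (u k * q (suc k)) (0≤u k ⊛ 0≤q (suc k)) (trans
             (solve 3 (λ q u v → (con 1ℚ :+ u) :* (q :+ con (ι 8) :* v) :=
                q :+ con (ι 8) :* (u :* v) :+ con (ι 8) :* u :- con (ι 4) :* (con (ι 2) :* (u :- v)) :+ u :* q)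
                refl (q (suc k)) (u k) (u (suc k)))
             (trans
               (cong (λ z → q (suc k) + ι 8 * (u k * u (suc k)) + ι 8 * u k - ι 4 * z + u k * q (suc k)) (u-diff k))
               (solve 3 (λ q u v → q :+ con (ι 8) :* (u :* v) :+ con (ι 8) :* u :- con (ι 4) :* (u :* v) :+ u :* q :=
                  q :+ con (ι 4) :* (u :* v) :+ con (ι 8) :* u :+ u :* q) refl (q (suc k)) (u k) (u (suc k))))) ⟩
      (1ℚ + u k) * (q (suc k) + ι 8 * u (suc k)) ∎)
    where open ≤-Reasoning

  -- The summand `ι 8 * u 0` is already 1.
  1≤c₀ : 1ℚ ≤ c 0
  1≤c₀ = ⊓-glb ≤-refl (≤-from-diff (q 0) (0≤q 0) (+-comm (q 0) 1ℚ))

  tolerance≤8u : ∀ k → tolerance k ≤ ι 8 * u k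
  tolerance≤8u k = ≤-from-diff (ι 8 * u (suc k)) (ι≥0 8 ⊛ 0≤u (suc k))
    (trans (solve 2 (λ u v → con (ι 8) :* u := con (ι 8) :* (u :- v) :+ con (ι 8) :* v) refl (u k) (u (suc k)))
           (cong (_+ ι 8 * u (suc k)) (sym (tolerance≡ k))))

  -- A representative of a real in [0, 1] may leave the interval by a slack `δ`, so clamping it
  -- costs at most `δ`. The tolerance and the added summand cost at most 8 u k each.
  c-close : ∀ k {m δ} → M k ℕ.≤ m → 0ℚ ≤ δ → 0ℚ ≤ seq m + δ → seq m ≤ 1ℚ + δ →
            ∣ c k - seq m ∣ ≤ ι 16 * u k + δ
  c-close k {m} {δ} M≤m 0≤δ 0≤s s≤1 = ∣∣≤ upper lower
    where
    open ≤-Reasoning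
    s = seq m
    8u = ι 8 * u k
    0≤8u : 0ℚ ≤ 8u
    0≤8u = ι≥0 8 ⊛ 0≤u k
    M≤ : seq (M k) ≤ s + 8u
    M≤ = ≤-trans (close₁ k M≤m) (+-monoʳ-≤ s (tolerance≤8u k))
    ≤M : s ≤ seq (M k) + 8u
    ≤M = ≤-trans (close₂ k M≤m) (+-monoʳ-≤ (seq (M k)) (tolerance≤8u k))
    q≤ : q k ≤ s + 8u + δ
    q≤ = q-lub k
      (≤-from-diff (s + δ + 8u) (0≤s ⊕ 0≤8u)
        (solve 3 (λ s t d → s :+ t :+ d := con 0ℚ :+ (s :+ d :+ t)) refl s 8u δ))
      (≤-from-diff (s + 8u - seq (M k) + δ) (0≤-diff M≤ ⊕ 0≤δ)
        (solve 4 (λ s t d m → s :+ t :+ d := m :+ (s :+ t :- m :+ d)) refl s 8u δ (seq (M k))))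
    upper : c k - s ≤ ι 16 * u k + δ
    upper = ≤-from-diff (q k + 8u - c k + (s + 8u + δ - q k)) (0≤-diff (c≤q+8u k) ⊕ 0≤-diff q≤)
      (solve 5 (λ c s u d q → con (ι 16) :* u :+ d :=
         c :- s :+ (q :+ con (ι 8) :* u :- c :+ (s :+ con (ι 8) :* u :+ d :- q))) refl (c k) s (u k) δ (q k))
    s-16u-δ≤c : s - (ι 16 * u k + δ) ≤ c k
    s-16u-δ≤c = ⊓-glb
      (≤-from-diff (1ℚ + δ - s + ι 16 * u k) (0≤-diff s≤1 ⊕ ι≥0 16 ⊛ 0≤u k)
        (solve 3 (λ s t d → con 1ℚ := s :- (t :+ d) :+ (con 1ℚ :+ d :- s :+ t)) refl s (ι 16 * u k) δ))
      (≤-from-diff (seq (M k) + 8u - s + (q k - seq (M k)) + (ι 16 * u k + δ))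
        (0≤-diff ≤M ⊕ 0≤-diff (seq≤q k) ⊕ (ι≥0 16 ⊛ 0≤u k ⊕ 0≤δ))
        (solve 5 (λ s t e m q → q :+ t := s :- e :+ (m :+ t :- s :+ (q :- m) :+ e))
           refl s 8u (ι 16 * u k + δ) (seq (M k)) (q k)))
    lower : - (c k - s) ≤ ι 16 * u k + δ
    lower = ≤-from-diff (c k - (s - (ι 16 * u k + δ))) (0≤-diff s-16u-δ≤c)
      (solve 3 (λ c s e → e := :- (c :- s) :+ (c :- (s :- e))) refl (c k) s (ι 16 * u k + δ))

-- The stages of the construction

-- The spacing by `X` makes `decay` applicable on every stage, and `main-term` for the primes up to
-- the start of a stage once that stage is over. The start 16 gives `16 + k ≤ T k`.
T : ℕ → ℕ
T zero    = 16
T (suc k) = X (T k)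

T-suc : ∀ k → T k ℕ.< T (suc k)
T-suc k = y<X (T k)

T-mono : ∀ {i j} → i ℕ.≤′ j → T i ℕ.≤ T j
T-mono ℕ.≤′-refl     = ℕ.≤-refl
T-mono {j = suc j} (ℕ.≤′-step r) = ℕ.≤-trans (T-mono r) (ℕ.<⇒≤ (T-suc j))

T-reflects-< : ∀ {i j} → T i ℕ.< T j → i ℕ.< j
T-reflects-< Ti<Tj = ℕ.≰⇒> λ j≤i → ℕ.<⇒≱ Ti<Tj (T-mono (ℕ.≤⇒≤′ j≤i))

16+k≤T : ∀ k → 16 ℕ.+ k ℕ.≤ T k
16+k≤T zero    = ℕ.≤-refl
16+k≤T (suc k) = ℕ.≤-trans (ℕ.≤-reflexive (ℕ.+-suc 16 k)) (ℕ.≤-<-trans (16+k≤T k) (T-suc k))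

-- The stage of `n`: `T (κ n) < n ≤ T (suc (κ n))`, except that stage 0 also takes in all `n` up to
-- `T 0`.
κ : ℕ → ℕ
κ zero    = 0
κ (suc n) with T (suc (κ n)) ℕ.≤? n
... | yes _ = suc (κ n)
... | no  _ = κ n

κ-cases : ∀ n → (T (suc (κ n)) ℕ.≤ n × κ (suc n) ≡ suc (κ n)) ⊎ (n ℕ.< T (suc (κ n)) × κ (suc n) ≡ κ n)
κ-cases n with T (suc (κ n)) ℕ.≤? n
... | yes T≤n = inj₁ (T≤n , refl)
... | no  T≰n = inj₂ (ℕ.≰⇒> T≰n , refl)

κ-upper : ∀ n → n ℕ.≤ T (suc (κ n))
κ-upper zero    = z≤n
κ-upper (suc n) =
  [ (λ (_ , eq) → subst (λ k → suc n ℕ.≤ T (suc k)) (sym eq) (ℕ.≤-<-trans (κ-upper n) (T-suc (suc (κ n)))))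
  , (λ (n< , eq) → subst (λ k → suc n ℕ.≤ T (suc k)) (sym eq) n<) ]′ (κ-cases n)

κ-lower : ∀ n {k} → k ℕ.< κ n → T (suc k) ℕ.< n
κ-lower (suc n) {k} k< =
  [ (λ (T≤n , eq) → s≤s (ℕ.≤-trans (T-mono (ℕ.≤⇒≤′ (subst (k ℕ.<_) eq k<))) T≤n))
  , (λ (_ , eq) → ℕ.m≤n⇒m≤1+n (κ-lower n (subst (k ℕ.<_) eq k<))) ]′ (κ-cases n)

κ-≥ : ∀ {n k} → T k ℕ.< n → k ℕ.≤ κ n
κ-≥ {n} Tk<n = ℕ.s≤s⁻¹ (T-reflects-< (ℕ.<-≤-trans Tk<n (κ-upper n)))

κ-≡ : ∀ {n k} → T k ℕ.< n → n ℕ.≤ T (suc k) → κ n ≡ k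
κ-≡ {n} Tk<n n≤T = ℕ.≤-antisym (ℕ.≮⇒≥ λ k< → ℕ.<⇒≱ (κ-lower n k<) n≤T) (κ-≥ Tk<n)

-- The product follows the threshold, and the averages follow the product

module Construction (α : ℝ) where

  open ℝ α using (seq)
  open Threshold α
  open Greedy (λ n → c (κ n))

  c∘κ-antitone : ∀ n → c (κ (suc n)) ≤ c (κ n)
  c∘κ-antitone n = [ (λ (_ , eq) → ≤-trans (≤-reflexive (cong c eq)) (c-antitone (κ n)))
                   , (λ (_ , eq) → ≤-reflexive (cong c eq)) ]′ (κ-cases n)

  c≤P : ∀ n {k} → κ n ≡ k → c k ≤ P n
  c≤P n eq = subst (λ k → c k ≤ P n) eq (θ≤P c∘κ-antitone (c≤1 0) n)

  κ-T : ∀ k → κ (T (suc k)) ≡ k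
  κ-T k = κ-≡ (T-suc k) ℕ.≤-refl

  Rejected : ℕ → ℕ → Set
  Rejected k t = T k ℕ.≤ t × Prime (suc t) × ¬ Accept t (P t)

  rejected? : ∀ k t → Dec (Rejected k t)
  rejected? k t = (T k ℕ.≤? t) ×-dec (prime? (suc t) ×-dec ¬? (accept? t (P t)))

  -- Rejection of `suc t` means that `P t` is below (1 + 2 / t) c k, which is at most (1 + u k) c k;
  -- afterwards `P` can only fall.
  after-rejection : ∀ k t → t ℕ.< T (suc k) → Rejected k t → P (T (suc k)) ≤ (1ℚ + u k) * c k
  after-rejection k t t< (T≤t , pr , ¬a) = *-cancel (ι-pos {15} {t} 16≤t) (begin
    ι t * P (T (suc k))
      ≤⟨ *-monoʳ (ι≥0 t) (P-antitone (ℕ.≤⇒≤′ (ℕ.<⇒≤ t<))) ⟩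
    ι t * P t
      ≡⟨ trans (*-comm (ι t) (P t)) (sym (ratio-* (P t) t)) ⟩
    P t * ratio t * ι (2 ℕ.+ t)
      ≤⟨ *-monoʳ-≤-nonNeg (ι (2 ℕ.+ t)) {{nonNegative (ι≥0 (2 ℕ.+ t))}} small ⟩
    c k * ι (2 ℕ.+ t)
      ≤⟨ ≤-from-diff ((u k * ι t - ι 2) * c k) (0≤-diff 2≤ut ⊛ <⇒≤ (0<c k))
           (solve 3 (λ c u t → t :* ((con 1ℚ :+ u) :* c) := c :* (con 1ℚ :+ (con 1ℚ :+ t)) :+ (u :* t :- con (ι 2)) :* c)
             refl (c k) (u k) (ι t)) ⟩
    ι t * ((1ℚ + u k) * c k) ∎)
    where
    open ≤-Reasoning
    16+k≤t : 16 ℕ.+ k ℕ.≤ t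
    16+k≤t = ℕ.≤-trans (16+k≤T k) T≤t
    16≤t : 16 ℕ.≤ t
    16≤t = ℕ.m+n≤o⇒m≤o 16 16+k≤t
    small : P t * ratio t ≤ c k
    small = <⇒≤ (subst (λ i → P t * ratio t < c i) (κ-≡ {suc t} {k} (s≤s T≤t) t<) (≰⇒> λ θ≤ → ¬a (pr , θ≤)))
    2≤ut : ι 2 ≤ u k * ι t
    2≤ut = subst (_≤ u k * ι t) (u-* k) (*-monoʳ (0≤u k) (ι-mono 16+k≤t))

  -- If the whole stage is accepted, `decay` leaves `P` at most (8/11) (81/64) c k = (648/704) c k.
  -- This contradicts `c≤P`, but the bound wanted follows directly, with 56 = 704 - 648 to spare.
  no-rejection : ∀ k → ι 64 * P (T k) ≤ ι 81 * c k → (∀ {t} → t ℕ.< T (suc k) → ¬ Rejected k t) →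
                 P (T (suc k)) ≤ (1ℚ + u k) * c k
  no-rejection k hyp none = *-cancel {ι 704} (ι>0 703)
    (≤-from-diff (ι 8 * (ι 81 * c k - ι 64 * P y) + ι 64 * (ι 8 * P y - ι 11 * P z) + (ι 56 + ι 704 * u k) * c k)
      (ι≥0 8 ⊛ 0≤-diff hyp ⊕ ι≥0 64 ⊛ 0≤-diff decayed ⊕ (ι≥0 56 ⊕ ι≥0 704 ⊛ 0≤u k) ⊛ <⇒≤ (0<c k))
      (solve 4 (λ c u p q → con (ι 704) :* ((con 1ℚ :+ u) :* c) :=
         con (ι 704) :* q :+ (con (ι 8) :* (con (ι 81) :* c :- con (ι 64) :* p)
           :+ con (ι 64) :* (con (ι 8) :* p :- con (ι 11) :* q) :+ (con (ι 56) :+ con (ι 704) :* u) :* c))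
         refl (c k) (u k) (P y) (P z)))
    where
    y = T k
    z = T (suc k)
    all-accepted : ∀ {t} → y ℕ.≤ t → t ℕ.< z → Step one nil ∣one∣≤1 ∣nil∣≤1 P t
    all-accepted {t} y≤t t<z = go (prime? (suc t))
      where
      go : Dec (Prime (suc t)) → Step one nil ∣one∣≤1 ∣nil∣≤1 P t
      go (no ¬pr) = inj₁ (inj₁ ¬pr , P-antitone (ℕ.≤′-step ℕ.≤′-refl))
      go (yes pr) = [ (λ (_ , eq) → inj₂ (pr , eq))
                    , (λ (¬a , _) → contradiction (y≤t , pr , ¬a) (none t<z)) ]′ (P-cases t)
    decayed : ι 11 * P z ≤ ι 8 * P y
    decayed = decay 0≤P (ℕ.≤-trans (ℕ.m≤m+n 3 13) (ℕ.m+n≤o⇒m≤o 16 (16+k≤T k))) ℕ.≤-refl all-accepted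

  window : ∀ k → ι 64 * P (T k) ≤ ι 81 * c k → P (T (suc k)) ≤ (1ℚ + u k) * c k
  window k hyp = go (ℕ.anyUpTo? (rejected? k) (T (suc k)))
    where
    go : Dec (∃[ t ] (t ℕ.< T (suc k) × Rejected k t)) → P (T (suc k)) ≤ (1ℚ + u k) * c k
    go (yes (t , t< , r)) = after-rejection k t t< r
    go (no none)          = no-rejection k hyp λ {t} t< r → none (t , t< , r)

  -- 81 / 64 = (9 / 8) ², where 9 / 8 bounds 1 + u k.
  P≤81/64c : ∀ k → ι 64 * P (T k) ≤ ι 81 * c k
  P≤81/64c zero = begin
    ι 64 * P 16  ≤⟨ *-monoʳ (ι≥0 64) (P≤1 16) ⟩
    ι 64 * 1ℚ    ≤⟨ *-monoʳ (ι≥0 64) 1≤c₀ ⟩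
    ι 64 * c 0   ≤⟨ ≤-from-diff (ι 17 * c 0) (ι≥0 17 ⊛ <⇒≤ (0<c 0))
                     (solve 1 (λ c → con (ι 81) :* c := con (ι 64) :* c :+ con (ι 17) :* c) refl (c 0)) ⟩
    ι 81 * c 0   ∎
    where open ≤-Reasoning
  P≤81/64c (suc k) = begin
    ι 64 * P (T (suc k))
      ≤⟨ *-monoʳ (ι≥0 64) (window k (P≤81/64c k)) ⟩
    ι 64 * ((1ℚ + u k) * c k)
      ≤⟨ *-monoʳ (ι≥0 64) (*-monoʳ (0≤1 ⊕ 0≤u k) (c-slow k)) ⟩
    ι 64 * ((1ℚ + u k) * ((1ℚ + u k) * c (suc k)))
      ≤⟨ ≤-from-diff ((1ℚ - ι 8 * u k) * (ι 17 + ι 8 * u k) * c (suc k))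
           (0≤-diff (8u≤1 k) ⊛ (ι≥0 17 ⊕ ι≥0 8 ⊛ 0≤u k) ⊛ <⇒≤ (0<c (suc k)))
           (solve 2 (λ u c → con (ι 81) :* c := con (ι 64) :* ((con 1ℚ :+ u) :* ((con 1ℚ :+ u) :* c))
              :+ (con 1ℚ :- con (ι 8) :* u) :* (con (ι 17) :+ con (ι 8) :* u) :* c) refl (u k) (c (suc k))) ⟩
    ι 81 * c (suc k) ∎
    where open ≤-Reasoning

  P≤c : ∀ k → P (T (suc k)) ≤ (1ℚ + u k) * c k
  P≤c k = window k (P≤81/64c k)

  -- The cube of 1 + w is 1 + 3 w + w (3 w + w²), and 3 w + w² is at most 1 when w is at most 1/8.
  cubed : ∀ {w p} → 0ℚ ≤ w → ι 8 * w ≤ 1ℚ → 0ℚ ≤ p →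
          (1ℚ + w) * ((1ℚ + w) * ((1ℚ + w) * p)) ≤ (1ℚ + ι 4 * w) * p
  cubed {w} {p} 0≤w 8w≤1 0≤p =
    ≤-from-diff (w * ((1ℚ - ι 8 * w) + w * (ι 4 + (1ℚ - ι 8 * w) + ι 7 * w)) * p)
      (0≤w ⊛ (0≤-diff 8w≤1 ⊕ 0≤w ⊛ (ι≥0 4 ⊕ 0≤-diff 8w≤1 ⊕ ι≥0 7 ⊛ 0≤w)) ⊛ 0≤p)
      (solve 2 (λ w p → (con 1ℚ :+ con (ι 4) :* w) :* p :=
         (con 1ℚ :+ w) :* ((con 1ℚ :+ w) :* ((con 1ℚ :+ w) :* p))
         :+ w :* ((con 1ℚ :- con (ι 8) :* w) :+ w :* (con (ι 4) :+ (con 1ℚ :- con (ι 8) :* w) :+ con (ι 7) :* w)) :* p)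
         refl w p)

  -- x lies in the stage after next, so that P varies little between T (suc k) and x.
  module _ {x k : ℕ} (stage : κ x ≡ 2 ℕ.+ k) where

    y : ℕ
    y = T (suc k)

    X≤x : X y ℕ.≤ x
    X≤x = ℕ.<⇒≤ (κ-lower x (subst (suc k ℕ.<_) (sym stage) ℕ.≤-refl))

    0<P : 0ℚ < P x
    0<P = <-≤-trans (0<c (2 ℕ.+ k)) (c≤P x stage)

    -- One factor 1 + u k comes from the excess of `P y` over `c k`, two more from the descent of
    -- `c` over two stages to a lower bound for `P x`.
    P-ratio : P y ≤ (1ℚ + ι 4 * u k) * P x
    P-ratio = begin
      P y
        ≤⟨ P≤c k ⟩
      v * c k
        ≤⟨ *-monoʳ 0≤v (c-slow k) ⟩
      v * (v * c (suc k))
        ≤⟨ *-monoʳ 0≤v (*-monoʳ 0≤v c₁≤) ⟩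
      v * (v * (v * P x))
        ≤⟨ cubed (0≤u k) (8u≤1 k) (0≤P x) ⟩
      (1ℚ + ι 4 * u k) * P x ∎
      where
      open ≤-Reasoning
      v = 1ℚ + u k
      0≤v : 0ℚ ≤ v
      0≤v = 0≤1 ⊕ 0≤u k
      c₁≤ : c (suc k) ≤ v * P x
      c₁≤ = begin
        c (suc k)                            ≤⟨ c-slow (suc k) ⟩
        (1ℚ + u (suc k)) * c (2 ℕ.+ k)       ≤⟨ *-monoʳ-≤-nonNeg (c (2 ℕ.+ k)) {{nonNegative (<⇒≤ (0<c (2 ℕ.+ k)))}}
                                                  (+-monoʳ-≤ 1ℚ (u-antitone k)) ⟩
        v * c (2 ℕ.+ k)                      ≤⟨ *-monoʳ 0≤v (c≤P x stage) ⟩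
        v * P x                              ∎

    h : ℚ
    h = H (sign A) one y x

    tail-small : ∣ F (sign A) x - h ∣ ≤ ι 8 * u k * ι x
    tail-small = *-cancel 0<P (begin
      P x * ∣ F (sign A) x - h ∣
        ≤⟨ tail-bound (ℕ.≤-trans (ℕ.<⇒≤ (y<X y)) X≤x) ⟩
      ι 2 * ι x * (P y - P x)
        ≤⟨ ≤-from-diff (ι 2 * ι x * ((1ℚ + ι 4 * u k) * P x - P y)) ((ι≥0 2 ⊛ ι≥0 x) ⊛ 0≤-diff P-ratio)
             (solve 4 (λ x p q u → q :* (con (ι 8) :* u :* x) :=
                con (ι 2) :* x :* (p :- q) :+ con (ι 2) :* x :* ((con 1ℚ :+ con (ι 4) :* u) :* q :- p))
                refl (ι x) (P y) (P x) (u k)) ⟩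
      P x * (ι 8 * u k * ι x) ∎)
      where open ≤-Reasoning

    -- The error is at most x / (y + 1), and y + 1 is at least 16 + k = 2 / u k.
    main-small : ∣ D y x ∣ ≤ u k * ι x
    main-small = *-cancel (ι>0 1) (begin
      ι 2 * ∣ D y x ∣
        ≡⟨ cong (_* ∣ D y x ∣) (u-* k) ⟨
      u k * ι (16 ℕ.+ k) * ∣ D y x ∣
        ≡⟨ solve 3 (λ u n d → u :* n :* d := u :* (d :* n)) refl (u k) (ι (16 ℕ.+ k)) (∣ D y x ∣) ⟩
      u k * (∣ D y x ∣ * ι (16 ℕ.+ k))
        ≤⟨ *-monoʳ (0≤u k) (*-monoʳ (0≤∣p∣ (D y x)) (ι-mono
             (ℕ.≤-trans (16+k≤T k) (ℕ.≤-trans (ℕ.<⇒≤ (T-suc k)) (ℕ.n≤1+n y))))) ⟩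
      u k * (∣ D y x ∣ * ι (suc y))
        ≤⟨ *-monoʳ (0≤u k) (main-term X≤x) ⟩
      u k * ι x
        ≤⟨ ≤-from-diff (u k * ι x) (0≤u k ⊛ ι≥0 x)
             (solve 1 (λ a → con (ι 2) :* a := a :+ a) refl (u k * ι x)) ⟩
      ι 2 * (u k * ι x) ∎)
      where open ≤-Reasoning

    F-close : ∣ F (sign A) x - P y * ι x ∣ ≤ ι 9 * u k * ι x
    F-close = begin
      ∣ F (sign A) x - P y * ι x ∣
        ≡⟨ cong ∣_∣ (solve 3 (λ a b c → a :- c := (a :- b) :+ (b :- c)) refl (F (sign A) x) h (P y * ι x)) ⟩
      ∣ (F (sign A) x - h) + D y x ∣
        ≤⟨ ∣p+q∣≤∣p∣+∣q∣ (F (sign A) x - h) (D y x) ⟩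
      ∣ F (sign A) x - h ∣ + ∣ D y x ∣
        ≤⟨ +-mono-≤ tail-small main-small ⟩
      ι 8 * u k * ι x + u k * ι x
        ≡⟨ solve 2 (λ u x → con (ι 8) :* u :* x :+ u :* x := con (ι 9) :* u :* x) refl (u k) (ι x) ⟩
      ι 9 * u k * ι x ∎
      where open ≤-Reasoning

    P-close : ∣ P y - c k ∣ ≤ u k
    P-close = ∣∣≤
      (≤-from-diff ((1ℚ + u k) * c k - P y + u k * (1ℚ - c k)) (0≤-diff (P≤c k) ⊕ 0≤u k ⊛ 0≤-diff (c≤1 k))
        (solve 3 (λ u c p → u := p :- c :+ ((con 1ℚ :+ u) :* c :- p :+ u :* (con 1ℚ :- c))) refl (u k) (c k) (P y)))
      (≤-from-diff (P y - c k + u k) (0≤-diff (c≤P y (κ-T k)) ⊕ 0≤u k)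
        (solve 3 (λ u c p → u := :- (p :- c) :+ (p :- c :+ u)) refl (u k) (c k) (P y)))

  average-close : ∀ {n k} → κ (suc n) ≡ 2 ℕ.+ k → ∣ average A (suc n) - P (T (suc k)) ∣ ≤ ι 9 * u k
  average-close {n} {k} stage = *-cancel (ι>0 n) (begin
    ι (suc n) * ∣ a - p ∣            ≡⟨ cong (_* ∣ a - p ∣) (0≤p⇒∣p∣≡p (ι≥0 (suc n))) ⟨
    ∣ ι (suc n) ∣ * ∣ a - p ∣        ≡⟨ ∣p*q∣≡∣p∣*∣q∣ (ι (suc n)) (a - p) ⟨
    ∣ ι (suc n) * (a - p) ∣
      ≡⟨ cong ∣_∣ (solve 3 (λ x a p → x :* (a :- p) := a :* x :- p :* x) refl (ι (suc n)) a p) ⟩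
    ∣ a * ι (suc n) - p * ι (suc n) ∣
      ≡⟨ cong (λ z → ∣ z - p * ι (suc n) ∣) (average*n A n) ⟩
    ∣ F (sign A) (suc n) - p * ι (suc n) ∣
      ≤⟨ F-close stage ⟩
    ι 9 * u k * ι (suc n)            ≡⟨ *-comm (ι 9 * u k) (ι (suc n)) ⟩
    ι (suc n) * (ι 9 * u k)          ∎)
    where
    open ≤-Reasoning
    a = average A (suc n)
    p = P (T (suc k))

  -- The constant is 9 + 1 + 16: from the average to `P`, from `P` to the threshold, and from the
  -- threshold to the sequence of `α`.
  average-seq : ∀ {n k m δ} → κ (suc n) ≡ 2 ℕ.+ k → M k ℕ.≤ m → 0ℚ ≤ δ → 0ℚ ≤ seq m + δ → seq m ≤ 1ℚ + δ →
                ∣ average A (suc n) - seq m ∣ ≤ ι 26 * u k + δ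
  average-seq {n} {k} {m} {δ} stage M≤m 0≤δ 0≤s s≤1 = begin
    ∣ a - s ∣
      ≡⟨ cong ∣_∣ (solve 4 (λ a p c s → a :- s := (a :- p) :+ ((p :- c) :+ (c :- s))) refl a p (c k) s) ⟩
    ∣ (a - p) + ((p - c k) + (c k - s)) ∣
      ≤⟨ ∣p+q∣≤∣p∣+∣q∣ (a - p) ((p - c k) + (c k - s)) ⟩
    ∣ a - p ∣ + ∣ (p - c k) + (c k - s) ∣
      ≤⟨ +-monoʳ-≤ (∣ a - p ∣) (∣p+q∣≤∣p∣+∣q∣ (p - c k) (c k - s)) ⟩
    ∣ a - p ∣ + (∣ p - c k ∣ + ∣ c k - s ∣)
      ≤⟨ +-mono-≤ (average-close stage) (+-mono-≤ (P-close stage) (c-close k M≤m 0≤δ 0≤s s≤1)) ⟩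
    ι 9 * u k + (u k + (ι 16 * u k + δ))
      ≡⟨ solve 2 (λ u d → con (ι 9) :* u :+ (u :+ (con (ι 16) :* u :+ d)) := con (ι 26) :* u :+ d) refl (u k) δ ⟩
    ι 26 * u k + δ ∎
    where
    open ≤-Reasoning
    a = average A (suc n)
    p = P (T (suc k))
    s = seq m

-- Passage to the limit in ℝ

archimedean : ∀ ε → 0ℚ < ε → ∃[ n ] (1ℚ ≤ ε * ι n)
archimedean (mkℚ (ℤ.+ zero) d _)     (*<* (ℤ.+<+ ()))
-- The witness is the denominator of `ε`: the product is the numerator, which is at least 1.
archimedean ε@(mkℚ (ℤ.+ suc n) d _)  _ = suc d , (begin
  1ℚ                               ≤⟨ ι-mono {1} {suc n} (s≤s z≤n) ⟩
  ι (suc n)                        ≡⟨ ι≡/1 (suc n) ⟩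
  ℤ.+ suc n / 1                    ≡⟨ /-*-cancel (ℤ.+ suc n) d ⟨
  (ℤ.+ suc n / suc d) * ι (suc d)  ≡⟨ cong (_* ι (suc d)) (↥p/↧p≡p ε) ⟩
  ε * ι (suc d)                    ∎)
  where open ≤-Reasoning
archimedean (mkℚ ℤ.-[1+ n ] d _)     (*<* ())

u-small : ∀ {ε n k} → 0ℚ < ε → 1ℚ ≤ ε * ι n → 52 ℕ.* n ℕ.≤ k → ι 26 * u k ≤ ε
u-small {ε} {n} {k} 0<ε 1≤εn 52n≤k = *-cancel (ι>0 (15 ℕ.+ k)) (begin
  ι (16 ℕ.+ k) * (ι 26 * u k)
    ≡⟨ solve 2 (λ a u → a :* (con (ι 26) :* u) := con (ι 26) :* (u :* a)) refl (ι (16 ℕ.+ k)) (u k) ⟩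
  ι 26 * (u k * ι (16 ℕ.+ k))  ≡⟨ cong (ι 26 *_) (u-* k) ⟩
  ι 52 * 1ℚ                    ≤⟨ *-monoʳ (ι≥0 52) 1≤εn ⟩
  ι 52 * (ε * ι n)             ≡⟨ solve 3 (λ a e n → a :* (e :* n) := e :* (a :* n)) refl (ι 52) ε (ι n) ⟩
  ε * (ι 52 * ι n)             ≡⟨ cong (ε *_) (ι-* 52 n) ⟨
  ε * ι (52 ℕ.* n)             ≤⟨ *-monoʳ (<⇒≤ 0<ε) (ι-mono (ℕ.m≤n⇒m≤o+n 16 52n≤k)) ⟩
  ε * ι (16 ℕ.+ k)             ≡⟨ *-comm ε (ι (16 ℕ.+ k)) ⟩
  ι (16 ℕ.+ k) * ε             ∎)
  where open ≤-Reasoning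

theorem4 : ∀ (α : ℝ) → 0ℝ Defs.≤ α → α Defs.≤ 1ℝ → ∃[ A ] (R[ A ]≡ α)
theorem4 α 0≤α α≤1 = Greedy.A (λ n → Threshold.c α (κ n)) , λ ε 0<ε → converges ε 0<ε (archimedean ε 0<ε)
  where
  open ℝ α
  open Threshold α
  open Construction α
  A = Greedy.A (λ n → c (κ n))
  converges : ∀ ε → 0ℚ < ε → ∃[ n ] (1ℚ ≤ ε * ι n) →
              ∃[ N ] (∀ n → N ℕ.≤ n → Defs.∣ fromℚ (average A (suc n)) Defs.- α ∣ Defs.≤ fromℚ ε)
  -- Past `T (2 + K)` the stage of `suc n` is `2 + k` with `k` at least `K`, so 26 u k is at most
  -- `ε`. The slack `δ` allowed by the order on ℝ is also the slack at which 0 ≤ α and α ≤ 1 are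
  -- used.
  converges ε 0<ε (j , 1≤εj) = T (2 ℕ.+ K) , λ n T≤n δ 0<δ →
    let k , stage , K≤k = split n T≤n
        N₀ , nonneg = 0≤α δ 0<δ
        N₁ , ≤one = α≤1 δ 0<δ
    in M k ℕ.⊔ (N₀ ℕ.⊔ N₁) , λ m N≤m →
      let N₀⊔N₁≤m = ℕ.m⊔n≤o⇒n≤o (M k) (N₀ ℕ.⊔ N₁) N≤m in
      ≤-trans (average-seq stage (ℕ.m⊔n≤o⇒m≤o (M k) (N₀ ℕ.⊔ N₁) N≤m) (<⇒≤ 0<δ)
                (nonneg m (ℕ.m⊔n≤o⇒m≤o N₀ N₁ N₀⊔N₁≤m)) (≤one m (ℕ.m⊔n≤o⇒n≤o N₀ N₁ N₀⊔N₁≤m)))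
              (+-monoˡ-≤ δ (u-small {n = j} 0<ε 1≤εj K≤k))
    where
    K = 52 ℕ.* j
    split : ∀ n → T (2 ℕ.+ K) ℕ.≤ n → ∃[ k ] (κ (suc n) ≡ 2 ℕ.+ k × K ℕ.≤ k)
    split n T≤n = κ (suc n) ℕ.∸ 2 , sym (ℕ.m+[n∸m]≡n (ℕ.m+n≤o⇒m≤o 2 2+K≤)) ,
      ℕ.m+n≤o⇒m≤o∸n K (subst (ℕ._≤ κ (suc n)) (ℕ.+-comm 2 K) 2+K≤)
      where
      2+K≤ : 2 ℕ.+ K ℕ.≤ κ (suc n)
      2+K≤ = κ-≥ {suc n} {2 ℕ.+ K} (s≤s T≤n)
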